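{- Let $n$ and $i$ be integers with $0 \leq i \leq n$. For each integer $m\ge 0$, let $C_{i,n}(m)$ be the number of $(n+1)$-coloured partitions of $m$ in $\mathcal{C}_n$ such that the last part is $0_{c_i}$ and the penultimate part has colour different from $c_i$. Let $C_{i,n}^{\geq}(m)$ be the number of $(n+1)$-coloured partitions of $m$ in $\mathcal{C}_n^{\geq}$ such that the last part is $0_{c_i}$ and the penultimate part is different from $0_{c_i}$. Then the following identities of formal power series in $q$ hold: $$\sum_{m\geq 0} C_{i,n}(m)q^m = \frac{(q^{i+1},q^{n-i+1},q^{n+2};q^{n+2})_\infty}{(q;q^2)_\infty(q;q)_\infty},$$ $$\sum_{m\geq 0} C_{i,n}^{\geq}(m)q^m = \frac{(q^{i+1},q^{n-i+1},q^{n+2};q^{n+2})_\infty}{(q;q^2)_\infty(q;q)^2_\infty}.$$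
   Context: For $N\in\mathbb{N}\cup\{\infty\}$, $(a;q)_N := \prod_{k=0}^{N-1}(1-aq^k)$ and $(a_1,\dots,a_j;q)_N := (a_1;q)_N\cdots(a_j;q)_N$. Let $n\ge 0$ be an integer and let $c_0,c_1,\dots,c_n$ be $n+1$ colours. An $(n+1)$-coloured part is a non-negative integer $k$ together with a colour $c_u$, written $k_{c_u}$. $\mathcal{C}_n$ denotes the set of finite non-empty sequences $(\lambda_1,\dots,\lambda_s)$ of coloured parts, $\lambda_j$ having colour $c_{u_j}$, such that (comparing the integer values of the parts) $\lambda_j-\lambda_{j+1}=|u_j-u_{j+1}|$ for all $1\le j\le s-1$. $\mathcal{C}_n^{\geq}$ denotes the set of such sequences satisfying instead $\lambda_j-\lambda_{j+1}\geq|u_j-u_{j+1}|$ for all $1\le j\le s-1$. Such a sequence is a coloured partition of $m$ if the sum of the integer values of its parts is $m$. The last part is $\lambda_s$ and the penultimate part is $\lambda_{s-1}$; for the one-term sequence $(0_{c_i})$ there is no penultimate part, the condition on it is vacuous, and this sequence is counted (with $m=0$). -}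

module Defs where

open import Data.Fin using (Fin; zero; suc; toℕ)
open import Data.Fin.Properties using (toℕ-fromℕ; toℕ-inject₁; toℕ<n; toℕ≤pred[n])
open import Data.Integer using (ℤ; +_; 0ℤ; 1ℤ; _+_; _-_; _*_; _≤_)
import Data.Integer.Properties as ℤ
open import Data.Integer.Tactic.RingSolver using (solve-∀)
open import Data.List using (List; []; _∷_; foldr; length)
import Data.List as List
open import Data.List.Membership.Propositional using (_∈_)
open import Data.List.NonEmpty using (List⁺; toList; last; snocView; _∷ʳ′_)
open import Data.List.Relation.Unary.Linked using (Linked)
open import Data.List.Relation.Unary.Unique.Propositional using (Unique)
open import Data.Maybe using (Maybe)
open import Data.Maybe.Relation.Unary.All using (All)
open import Data.Nat using (ℕ; zero; suc; _∸_; ∣_-_∣)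
import Data.Nat as ℕ
open import Data.Nat.ListAction using () renaming (sum to sumℕ)
import Data.Nat.Properties as ℕ
open import Data.Product using (_×_; ∃-syntax)
open import Function using (_⇔_)
open import Level using (0ℓ)
open import Relation.Binary.PropositionalEquality
open import Relation.Nullary using (yes; no)
open import Relation.Unary using (Pred)

open import Algebra.Properties.Semiring.Sum ℤ.+-*-semiring
  using (sum; sum-cong-≗; sum-replicate-zero; sum-init-last; ∑-comm; ∑-distrib-+; *-distribˡ-sum)

-- Formal power series in one variable q, as coefficient sequences.
-- Equality of series is pointwise equality _≗_.

Series : Set
Series = ℕ → ℤ

infixl 6 _-ₛ_
infixl 7 _*ₛ_ _/ₛ_
infixr 8 _^ₛ_
infix  9 _⁻¹ₛ

1ₛ : Series
1ₛ zero    = 1ℤ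
1ₛ (suc _) = 0ℤ

q : Series
q zero          = 0ℤ
q (suc zero)    = 1ℤ
q (suc (suc _)) = 0ℤ

_-ₛ_ : Series → Series → Series
(f -ₛ g) m = f m - g m

_*ₛ_ : Series → Series → Series
(f *ₛ g) m = sum {suc m} λ k → f (toℕ k) * g (m ∸ toℕ k)

_^ₛ_ : Series → ℕ → Series
f ^ₛ zero  = 1ₛ
f ^ₛ suc k = f *ₛ f ^ₛ k

-- The partial sum 1 + (1 - f) + ⋯ + (1 - f)^M.
geometric : Series → ℕ → Series
geometric f M m = sum {suc M} λ k → ((1ₛ -ₛ f) ^ₛ toℕ k) m

-- The geometric series for 1/(1 - (1 - f)).  If f has constant term 1, powers
-- of 1 - f above the m-th do not reach the m-th coefficient, and this is the
-- multiplicative inverse of f (*ₛ-inverseʳ below).  For other f it has no meaning.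
_⁻¹ₛ : Series → Series
(f ⁻¹ₛ) m = geometric f m m

_/ₛ_ : Series → Series → Series
f /ₛ g = f *ₛ g ⁻¹ₛ

-- (a ; x)_N = ∏_{k < N} (1 - a x^k)
poch : Series → Series → ℕ → Series
poch a x zero    = 1ₛ
poch a x (suc N) = poch a x N *ₛ (1ₛ -ₛ a *ₛ x ^ₛ N)

-- (a ; x)_∞ for x without constant term: the factors with k > m are 1 + O(q^{m+1}),
-- so the m-th coefficient of (a ; x)_N is the same for all N > m (poch-limit below).
poch∞ : Series → Series → Series
poch∞ a x m = poch a x (suc m) m

-- (a₁ , … , a_j ; x)_∞
pochs∞ : List Series → Series → Series
pochs∞ as x = foldr (λ a f → poch∞ a x *ₛ f) 1ₛ as

genFun : (ℕ → ℕ) → Series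
genFun c m = + c m

-- The colour c_u is represented by its index u ∈ {0 , … , n}.
record ColouredPart (n : ℕ) : Set where
  constructor part
  field
    value  : ℕ
    colour : Fin (suc n)

open ColouredPart public

colourDist : ∀ {n} → ColouredPart n → ColouredPart n → ℕ
colourDist p r = ∣ toℕ (colour p) - toℕ (colour r) ∣

𝒞 : ∀ n → Pred (List⁺ (ColouredPart n)) 0ℓ
𝒞 n π = Linked (λ p r → + value p - + value r ≡ + colourDist p r) (toList π)

𝒞≥ : ∀ n → Pred (List⁺ (ColouredPart n)) 0ℓ
𝒞≥ n π = Linked (λ p r → + colourDist p r ≤ + value p - + value r) (toList π)

weight : ∀ {n} → List⁺ (ColouredPart n) → ℕ
weight π = sumℕ (List.map value (toList π))

penultimate : ∀ {A : Set} → List⁺ A → Maybe A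
penultimate xs with snocView xs
... | ys ∷ʳ′ _ = List.last ys

-- All holds vacuously when there is no penultimate part.
CountedByC : ∀ n → Fin (suc n) → ℕ → Pred (List⁺ (ColouredPart n)) 0ℓ
CountedByC n i m π =
    𝒞 n π
  × weight π ≡ m
  × last π ≡ part 0 i
  × All (λ p → colour p ≢ i) (penultimate π)

CountedByC≥ : ∀ n → Fin (suc n) → ℕ → Pred (List⁺ (ColouredPart n)) 0ℓ
CountedByC≥ n i m π =
    𝒞≥ n π
  × weight π ≡ m
  × last π ≡ part 0 i
  × All (λ p → p ≢ part 0 i) (penultimate π)

-- Exactly k elements satisfy P (in particular, finitely many do).
HasCount : {A : Set} → Pred A 0ℓ → ℕ → Set
HasCount P k = ∃[ xs ] Unique xs × (∀ x → x ∈ xs ⇔ P x) × length xs ≡ k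

-- f = O(q^k)
Order≥ : ℕ → Series → Set
Order≥ k f = ∀ j → j ℕ.< k → f j ≡ 0ℤ

sum-zero : ∀ {n} (t : Fin n → ℤ) → (∀ k → t k ≡ 0ℤ) → sum t ≡ 0ℤ
sum-zero {n} t t≡0 = trans (sum-cong-≗ t≡0) (sum-replicate-zero n)

sum-last : ∀ n (t : ℕ → ℤ) → sum {suc n} (λ k → t (toℕ k)) ≡ sum {n} (λ k → t (toℕ k)) + t n
sum-last n t = trans (sum-init-last {n} (λ k → t (toℕ k)))
  (cong₂ _+_ (sum-cong-≗ {n} λ k → cong t (toℕ-inject₁ k)) (cong t (toℕ-fromℕ n)))

*ₛ-order : ∀ {a b f g} → Order≥ a f → Order≥ b g → Order≥ (a ℕ.+ b) (f *ₛ g)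
*ₛ-order {a} {b} {f} {g} f≥a g≥b j j<a+b = sum-zero {suc j} _ term
  where
  term : ∀ (k : Fin (suc j)) → f (toℕ k) * g (j ∸ toℕ k) ≡ 0ℤ
  term k with toℕ k ℕ.<? a
  ... | yes k<a = cong (_* g (j ∸ toℕ k)) (f≥a _ k<a)
  ... | no  k≮a = trans (cong (f (toℕ k) *_) (g≥b _ j-k<b)) (ℤ.*-zeroʳ (f (toℕ k)))
    where
    open ℕ.≤-Reasoning
    k≤j : toℕ k ℕ.≤ j
    k≤j = toℕ≤pred[n] k
    j-k<b : j ∸ toℕ k ℕ.< b
    j-k<b = ℕ.+-cancelʳ-< (toℕ k) (j ∸ toℕ k) b (begin-strict
      j ∸ toℕ k ℕ.+ toℕ k ≡⟨ ℕ.m∸n+n≡m k≤j ⟩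
      j                   <⟨ j<a+b ⟩
      a ℕ.+ b             ≡⟨ ℕ.+-comm a b ⟩
      b ℕ.+ a             ≤⟨ ℕ.+-monoʳ-≤ b (ℕ.≮⇒≥ k≮a) ⟩
      b ℕ.+ toℕ k         ∎)

^ₛ-order : ∀ f → f 0 ≡ 0ℤ → ∀ k → Order≥ k (f ^ₛ k)
^ₛ-order f f₀≡0 zero    _ ()
^ₛ-order f f₀≡0 (suc k) = *ₛ-order {1} {k} {f} {f ^ₛ k} order1 (^ₛ-order f f₀≡0 k)
  where
  order1 : Order≥ 1 f
  order1 zero    _           = f₀≡0
  order1 (suc _) (ℕ.s≤s ())

*ₛ-congˡ≤ : ∀ f {g h} m → (∀ j → j ℕ.≤ m → g j ≡ h j) → (f *ₛ g) m ≡ (f *ₛ h) m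
*ₛ-congˡ≤ f m g≡h = sum-cong-≗ {suc m} λ k → cong (f (toℕ k) *_) (g≡h _ (ℕ.m∸n≤m m (toℕ k)))

*ₛ-identityˡ : ∀ f → 1ₛ *ₛ f ≗ f
*ₛ-identityˡ f m = begin
  1ℤ * f m + sum {m} (λ k → 0ℤ * f (m ∸ suc (toℕ k)))  ≡⟨ cong₂ _+_ (ℤ.*-identityˡ (f m)) (sum-zero {m} _ λ _ → refl) ⟩
  f m + 0ℤ                                             ≡⟨ ℤ.+-identityʳ (f m) ⟩
  f m                                                  ∎
  where open ≡-Reasoning

*ₛ-identityʳ : ∀ f → f *ₛ 1ₛ ≗ f
*ₛ-identityʳ f m = begin
  sum {suc m} (λ k → t (toℕ k))              ≡⟨ sum-last m t ⟩
  sum {m} (λ k → t (toℕ k)) + t m            ≡⟨ cong₂ _+_ (sum-zero {m} _ λ k → early (toℕ k) (toℕ<n k)) final ⟩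
  0ℤ + f m                                   ≡⟨ ℤ.+-identityˡ (f m) ⟩
  f m                                        ∎
  where
  open ≡-Reasoning
  t : ℕ → ℤ
  t k = f k * 1ₛ (m ∸ k)
  1ₛ-pos : ∀ {j} → 0 ℕ.< j → 1ₛ j ≡ 0ℤ
  1ₛ-pos (ℕ.s≤s _) = refl
  early : ∀ k → k ℕ.< m → t k ≡ 0ℤ
  early k k<m = trans (cong (f k *_) (1ₛ-pos (ℕ.m<n⇒0<n∸m k<m))) (ℤ.*-zeroʳ (f k))
  final : t m ≡ f m
  final = trans (cong (λ j → f m * 1ₛ j) (ℕ.n∸n≡0 m)) (ℤ.*-identityʳ (f m))

-- For x without constant term, (a ; x)_∞ is the coefficientwise limit of (a ; x)_N.
poch-limit : ∀ a {x} → x 0 ≡ 0ℤ → ∀ m N → m ℕ.< N → poch a x N m ≡ poch∞ a x m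
poch-limit a {x} x₀≡0 m N m<N = go (ℕ.≤⇒≤′ m<N)
  where
  step : ∀ K → m ℕ.< K → poch a x (suc K) m ≡ poch a x K m
  step K m<K = trans (*ₛ-congˡ≤ (poch a x K) m factor) (*ₛ-identityʳ (poch a x K) m)
    where
    factor : ∀ j → j ℕ.≤ m → (1ₛ -ₛ a *ₛ x ^ₛ K) j ≡ 1ₛ j
    factor j j≤m = trans
      (cong (λ z → 1ₛ j - z) (*ₛ-order {0} {K} {a} {x ^ₛ K} (λ _ ()) (^ₛ-order x x₀≡0 K) j (ℕ.≤-<-trans j≤m m<K)))
      (ℤ.+-identityʳ (1ₛ j))
  go : ∀ {K} → suc m ℕ.≤′ K → poch a x K m ≡ poch∞ a x m
  go ℕ.≤′-refl          = refl
  go (ℕ.≤′-step {K} m<K) = trans (step K (ℕ.≤′⇒≤ m<K)) (go m<K)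

*ₛ-constant : ∀ f g → (f *ₛ g) 0 ≡ f 0 * g 0
*ₛ-constant f g = ℤ.+-identityʳ (f 0 * g 0)

*ₛ-constant-1 : ∀ f g → f 0 ≡ 1ℤ → g 0 ≡ 1ℤ → (f *ₛ g) 0 ≡ 1ℤ
*ₛ-constant-1 f g f₀≡1 g₀≡1 = trans (*ₛ-constant f g) (cong₂ _*_ f₀≡1 g₀≡1)

poch∞-constant : ∀ a x → a 0 ≡ 0ℤ → poch∞ a x 0 ≡ 1ℤ
poch∞-constant a x a₀≡0 = *ₛ-constant-1 1ₛ (1ₛ -ₛ a *ₛ 1ₛ) refl
  (cong (λ z → 1ℤ - z) (trans (*ₛ-constant a 1ₛ) (cong (_* 1ℤ) a₀≡0)))

*ₛ-inverseʳ : ∀ f → f 0 ≡ 1ℤ → f *ₛ f ⁻¹ₛ ≗ 1ₛ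
*ₛ-inverseʳ f f₀≡1 m = begin
  (f *ₛ f ⁻¹ₛ) m                                ≡⟨ *ₛ-congˡ≤ f m (λ j j≤m → sym (stable (ℕ.≤⇒≤′ j≤m))) ⟩
  (f *ₛ S) m                                    ≡⟨ split ⟩
  S m - (g *ₛ S) m                              ≡⟨ cong (λ z → S m - z) shift ⟩
  S m - sum {suc m} (λ k → (g ^ₛ suc (toℕ k)) m) ≡⟨ telescope ⟩
  1ₛ m - (g ^ₛ suc m) m                         ≡⟨ cong (λ z → 1ₛ m - z) (^ₛ-order g g₀≡0 (suc m) m ℕ.≤-refl) ⟩
  1ₛ m - 0ℤ                                     ≡⟨ ℤ.+-identityʳ (1ₛ m) ⟩
  1ₛ m                                          ∎
  where
  open ≡-Reasoning
  g : Series
  g = 1ₛ -ₛ f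
  S : Series
  S = geometric f m

  g₀≡0 : g 0 ≡ 0ℤ
  g₀≡0 = cong (λ z → 1ℤ - z) f₀≡1

  stable : ∀ {j M} → j ℕ.≤′ M → geometric f M j ≡ geometric f j j
  stable ℕ.≤′-refl = refl
  stable {j} (ℕ.≤′-step {M} j≤M) = begin
    geometric f (suc M) j                 ≡⟨ sum-last (suc M) (λ k → (g ^ₛ k) j) ⟩
    geometric f M j + (g ^ₛ suc M) j      ≡⟨ cong₂ _+_ (stable j≤M) (^ₛ-order g g₀≡0 (suc M) j (ℕ.s≤s (ℕ.≤′⇒≤ j≤M))) ⟩
    geometric f j j + 0ℤ                  ≡⟨ ℤ.+-identityʳ _ ⟩
    geometric f j j                       ∎

  move : ∀ a b c → a + b ≡ c → a ≡ c - b
  move a b .(a + b) refl = lemma a b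
    where
    lemma : ∀ a b → a ≡ a + b - b
    lemma = solve-∀

  distrib : ∀ a b c → a * c + (b - a) * c ≡ b * c
  distrib = solve-∀

  split : (f *ₛ S) m ≡ S m - (g *ₛ S) m
  split = move _ _ _ (begin
    (f *ₛ S) m + (g *ₛ S) m
      ≡⟨ ∑-distrib-+ {suc m} (λ k → f (toℕ k) * S (m ∸ toℕ k)) (λ k → g (toℕ k) * S (m ∸ toℕ k)) ⟨
    sum {suc m} (λ k → f (toℕ k) * S (m ∸ toℕ k) + g (toℕ k) * S (m ∸ toℕ k))
      ≡⟨ sum-cong-≗ {suc m} (λ k → distrib (f (toℕ k)) (1ₛ (toℕ k)) (S (m ∸ toℕ k))) ⟩
    (1ₛ *ₛ S) m
      ≡⟨ *ₛ-identityˡ S m ⟩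
    S m ∎)

  shift : (g *ₛ S) m ≡ sum {suc m} (λ k → (g ^ₛ suc (toℕ k)) m)
  shift = trans
    (sum-cong-≗ {suc m} λ j → *-distribˡ-sum {suc m} (g (toℕ j)) (λ k → (g ^ₛ toℕ k) (m ∸ toℕ j)))
    (∑-comm {suc m} {suc m} λ j k → g (toℕ j) * (g ^ₛ toℕ k) (m ∸ toℕ j))

  cancel : ∀ a b c → a + b - (b + c) ≡ a - c
  cancel = solve-∀

  telescope : S m - sum {suc m} (λ k → (g ^ₛ suc (toℕ k)) m) ≡ 1ₛ m - (g ^ₛ suc m) m
  telescope = trans
    (cong (λ z → S m - z) (sum-last m (λ k → (g ^ₛ suc k) m)))
    (cancel (1ₛ m) (sum {m} λ k → (g ^ₛ suc (toℕ k)) m) ((g ^ₛ suc m) m))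

{-# OPTIONS --safe #-}

-- Let x = q^N. Up to repetitions of the last part 0_{c_i}, the sequences in 𝒞_n are
-- colour sequences, so the coefficients of the first series are those of (T_N ⋯ T_1 1)(i)
-- for large N, where T_N is the transfer matrix with entries x^|u-v|. Allowing larger gaps,
-- as in 𝒞_n^≥, multiplies T_N by 1 + x + x² + ⋯ = 1/(1-x), which yields the second series.
-- The inverse of T_N is tridiagonal, and this shows
--   (T_N ⋯ T_1 1)(v) = (q²;q²)_N ∑_k (-1)^k Q^{k(k-1)/2} q^{(v+1)k} / ((q;q)_{N-k} (q;q)_{N+k})
-- with Q = q^{n+2}: the interior equations hold term by term, and the two boundary
-- equations hold because k ↦ 1-k and k ↦ -1-k reverse the signs of the terms.
-- As N → ∞ the theta series that remains is the Jacobi triple product.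

module Submission where

open import Defs
open import Algebra.Bundles using (CommutativeRing)
import Algebra.Properties.Ring as RingProperties
import Algebra.Properties.Semiring.Exp as SemiringExp
import Algebra.Properties.Semiring.Mult.TCOptimised as SemiringMult
import Algebra.Properties.Semiring.Sum as SemiringSum
import Algebra.Solver.Ring
open import Algebra.Solver.Ring.AlmostCommutativeRing using (_-Raw-AlmostCommutative⟶_; fromCommutativeRing)
open import Algebra.Structures using (IsCommutativeRing)
open import Data.Fin using (Fin; zero; suc; toℕ; fromℕ<)
open import Data.Fin.Properties using (toℕ≤pred[n]; toℕ-injective; toℕ-fromℕ<) renaming (_≟_ to _≟ᶠ_)
open import Data.Integer as ℤ using (ℤ; +_; -[1+_]; _⊖_; 0ℤ; 1ℤ)
import Data.Integer.Properties as ℤ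
open import Data.Integer.Tactic.RingSolver using () renaming (solve-∀ to solveℤ-∀)
open import Data.List as List using (List; []; _∷_; _++_; allFin; tabulate; cartesianProduct; cartesianProductWith; filter; length; initLast)
open import Data.List.Membership.Propositional using (_∈_)
open import Data.List.Membership.Propositional.Properties using (∈-cartesianProductWith⁺; ∈-cartesianProductWith⁻; ∈-cartesianProduct⁺; ∈-allFin; ∈-filter⁺; ∈-filter⁻)
open import Data.List.NonEmpty as List⁺ using (List⁺; toList; head; last; _∷⁺_; _∷_)
open import Data.List.Properties using (filter-accept; filter-reject)
open import Data.List.Relation.Unary.All using ([]; _∷_)
open import Data.List.Relation.Unary.AllPairs using ([]; _∷_)
open import Data.List.Relation.Unary.Any using (here)
open import Data.List.Relation.Unary.Linked using (Linked; [-]; _∷_)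
open import Data.List.Relation.Unary.Unique.Propositional using (Unique)
import Data.List.Relation.Unary.Unique.Propositional.Properties as Unique
open import Data.Maybe using (Maybe; just; nothing)
open import Data.Maybe.Relation.Unary.All as Maybe using (just; nothing)
open import Data.Nat as ℕ using (ℕ; zero; suc; ∣_-_∣; _∸_; z≤n; s≤s)
import Data.Nat.Properties as ℕ
open import Data.Nat.Solver using (module +-*-Solver)
open import Data.Product using (_,_; ∃-syntax)
open import Data.Sum using (_⊎_; inj₁; inj₂)
open import Data.Unit using (⊤; tt)
open import Function using (_∘_; mk⇔)
open import Level using (0ℓ; _⊔_)
open import Relation.Binary.PropositionalEquality as ≡ using (_≡_; _≢_; _≗_)
import Relation.Binary.Reasoning.Setoid as SetoidReasoning
open import Relation.Nullary using (Dec; yes; no; ¬_; contradiction)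
open import Relation.Nullary.Decidable using (map′; _×-dec_)

-- Neither limits nor negative powers occur. For fixed m everything takes place modulo q^(m+1), so
-- the algebra is done over an arbitrary commutative ring in which the 1 - q^k with k ≥ 1 are
-- invertible and y + y = 0 forces y = 0. As z need not be invertible there, a theta series is
-- carried by a pair z, w with z w = Q, and its index k is r - N for r + s = 2N. N = 2m + 1 replaces
-- N → ∞: a term that survives has |k| ≤ m, so N + k and N - k both exceed m and the denominators
-- have reached their limits. The theta series is eliminated by comparison: the bilateral sum with
-- denominators in base Q instead of q has the same numerators, and for every N it is a quotient of
-- products. The denominator (q;q^2)_∞ comes from (q;q)_{2N} = (q;q^2)_N (q^2;q^2)_N. The number of
-- matrix factors is fixed while sequences vary in length, so short sequences are padded by the last
-- part; the condition on the penultimate part makes the padding unambiguous.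

-- Finite identities in a commutative ring

-- The library's ring solver cancels terms only if its coefficients have
-- decidable equality, so it is used here with integer coefficients.
module IntegerCoefficients {c ℓ} (R : CommutativeRing c ℓ) where
  open CommutativeRing R
  open RingProperties ring
  open SemiringMult semiring
  open SetoidReasoning setoid

  ι : ℤ → Carrier
  ι (+ n)    = n × 1#
  ι -[1+ n ] = - (suc n × 1#)

  cancel-summand : ∀ x y z → (z + x) - (z + y) ≈ x - y
  cancel-summand x y z = begin
    (z + x) - (z + y)     ≈⟨ +-cong (+-comm z x) (sym (-‿+-comm z y)) ⟩
    (x + z) + (- z - y)   ≈⟨ +-assoc x z _ ⟩
    x + (z + (- z - y))   ≈⟨ +-congˡ (sym (+-assoc z (- z) (- y))) ⟩
    x + ((z - z) - y)     ≈⟨ +-congˡ (+-congʳ (-‿inverseʳ z)) ⟩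
    x + (0# - y)          ≈⟨ +-congˡ (+-identityˡ (- y)) ⟩
    x - y                 ∎

  ι-⊖ : ∀ m n → ι (m ⊖ n) ≈ m × 1# - n × 1#
  ι-⊖ m       zero    = sym (trans (+-congˡ -0#≈0#) (+-identityʳ _))
  ι-⊖ zero    (suc n) = sym (+-identityˡ _)
  ι-⊖ (suc m) (suc n) = begin
    ι (suc m ⊖ suc n)                     ≡⟨ ≡.cong ι (ℤ.[1+m]⊖[1+n]≡m⊖n m n) ⟩
    ι (m ⊖ n)                             ≈⟨ ι-⊖ m n ⟩
    m × 1# - n × 1#                       ≈⟨ cancel-summand _ _ 1# ⟨
    (1# + m × 1#) - (1# + n × 1#)         ≈⟨ +-cong (×-homo-+ 1# 1 m) (-‿cong (×-homo-+ 1# 1 n)) ⟨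
    suc m × 1# - suc n × 1#               ∎

  ι-neg : ∀ i → ι (ℤ.- i) ≈ - ι i
  ι-neg (+ zero)   = sym -0#≈0#
  ι-neg (+ suc n)  = refl
  ι-neg (-[1+ n ]) = sym (-‿involutive _)

  ι-+ : ∀ i j → ι (i ℤ.+ j) ≈ ι i + ι j
  ι-+ (+ m)    (+ n)    = ×-homo-+ 1# m n
  ι-+ (+ m)    -[1+ n ] = ι-⊖ m (suc n)
  ι-+ -[1+ m ] (+ n)    = trans (ι-⊖ n (suc m)) (+-comm _ _)
  ι-+ -[1+ m ] -[1+ n ] = begin
    - (suc (suc (m ℕ.+ n)) × 1#)          ≡⟨ ≡.cong (λ k → - (suc k × 1#)) (ℕ.+-suc m n) ⟨
    - ((suc m ℕ.+ suc n) × 1#)            ≈⟨ -‿cong (×-homo-+ 1# (suc m) (suc n)) ⟩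
    - (suc m × 1# + suc n × 1#)           ≈⟨ -‿+-comm _ _ ⟨
    - (suc m × 1#) - suc n × 1#           ∎

  ι-*-pos : ∀ m j → ι (+ m ℤ.* j) ≈ ι (+ m) * ι j
  ι-*-pos m (+ n)    = begin
    ι (+ m ℤ.* + n)  ≡⟨ ≡.cong ι (ℤ.pos-* m n) ⟨
    (m ℕ.* n) × 1#   ≈⟨ ×1-homo-* m n ⟩
    m × 1# * n × 1#  ∎
  ι-*-pos m -[1+ n ] = begin
    ι (+ m ℤ.* -[1+ n ])          ≡⟨ ≡.cong ι (ℤ.neg-distribʳ-* (+ m) (+ suc n)) ⟨
    ι (ℤ.- (+ m ℤ.* + suc n))     ≈⟨ ι-neg (+ m ℤ.* + suc n) ⟩
    - ι (+ m ℤ.* + suc n)         ≈⟨ -‿cong (ι-*-pos m (+ suc n)) ⟩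
    - (m × 1# * suc n × 1#)       ≈⟨ -‿distribʳ-* _ _ ⟩
    m × 1# * - (suc n × 1#)       ∎

  ι-* : ∀ i j → ι (i ℤ.* j) ≈ ι i * ι j
  ι-* (+ m)    j = ι-*-pos m j
  ι-* -[1+ m ] j = begin
    ι (-[1+ m ] ℤ.* j)            ≡⟨ ≡.cong ι (ℤ.neg-distribˡ-* (+ suc m) j) ⟨
    ι (ℤ.- (+ suc m ℤ.* j))       ≈⟨ ι-neg (+ suc m ℤ.* j) ⟩
    - ι (+ suc m ℤ.* j)           ≈⟨ -‿cong (ι-*-pos (suc m) j) ⟩
    - (suc m × 1# * ι j)          ≈⟨ -‿distribˡ-* _ _ ⟩
    - (suc m × 1#) * ι j          ∎

  ℤ-homomorphism : CommutativeRing.rawRing ℤ.+-*-commutativeRing -Raw-AlmostCommutative⟶ fromCommutativeRing R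
  ℤ-homomorphism = record
    { ⟦_⟧    = ι
    ; +-homo = ι-+
    ; *-homo = ι-*
    ; -‿homo = ι-neg
    ; 0-homo = refl
    ; 1-homo = refl
    }

  ι-≟ : ∀ i j → Maybe (ι i ≈ ι j)
  ι-≟ i j with i ℤ.≟ j
  ... | yes i≡j = just (reflexive (≡.cong ι i≡j))
  ... | no  _   = nothing

  open Algebra.Solver.Ring (CommutativeRing.rawRing ℤ.+-*-commutativeRing) (fromCommutativeRing R) ℤ-homomorphism ι-≟ public
    using (solve; _:=_; _:+_; _:*_; _:-_; :-_; con)

-- Sums over r + s = L

module AntidiagonalSum {c ℓ} (R : CommutativeRing c ℓ) where
  open CommutativeRing R
  open IntegerCoefficients R using (solve; _:=_; _:+_; _:*_; _:-_; :-_; con)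
  open SetoidReasoning setoid

  -- The summand receives both indices, so that bilateral sums with denominators (q;q)_{N+k} and
  -- (q;q)_{N-k} need no subtraction: r = N + k and s = N - k.
  anti : ℕ → (ℕ → ℕ → Carrier) → Carrier
  anti zero    F = F 0 0
  anti (suc L) F = F 0 (suc L) + anti L (λ r → F (suc r))

  anti-cong : ∀ L {F G} → (∀ r s → r ℕ.+ s ≡ L → F r s ≈ G r s) → anti L F ≈ anti L G
  anti-cong zero    F≈G = F≈G 0 0 ≡.refl
  anti-cong (suc L) F≈G = +-cong (F≈G 0 (suc L) ≡.refl)
    (anti-cong L λ r s r+s≡L → F≈G (suc r) s (≡.cong suc r+s≡L))

  anti-last : ∀ L F → anti (suc L) F ≈ anti L (λ r s → F r (suc s)) + F (suc L) 0
  anti-last zero    F = refl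
  anti-last (suc L) F = trans (+-congˡ (anti-last L (λ r → F (suc r)))) (sym (+-assoc _ _ _))

  anti-flip : ∀ L F → anti L F ≈ anti L (λ r s → F s r)
  anti-flip zero    F = refl
  anti-flip (suc L) F = begin
    F 0 (suc L) + anti L (λ r → F (suc r))        ≈⟨ +-comm _ _ ⟩
    anti L (λ r → F (suc r)) + F 0 (suc L)        ≈⟨ +-congʳ (anti-flip L (λ r → F (suc r))) ⟩
    anti L (λ r s → F (suc s) r) + F 0 (suc L)    ≈⟨ anti-last L (λ r s → F s r) ⟨
    anti (suc L) (λ r s → F s r)                  ∎

  anti-+ : ∀ L F G → anti L (λ r s → F r s + G r s) ≈ anti L F + anti L G
  anti-+ zero    F G = refl
  anti-+ (suc L) F G = trans (+-congˡ (anti-+ L (λ r → F (suc r)) (λ r → G (suc r))))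
    (solve 4 (λ a b c d → (a :+ b) :+ (c :+ d) := (a :+ c) :+ (b :+ d)) refl _ _ _ _)

  anti-* : ∀ L x F → anti L (λ r s → x * F r s) ≈ x * anti L F
  anti-* zero    x F = refl
  anti-* (suc L) x F = trans (+-congˡ (anti-* L x (λ r → F (suc r)))) (sym (distribˡ x _ _))

  anti-neg : ∀ L F → anti L (λ r s → - F r s) ≈ - anti L F
  anti-neg zero    F = refl
  anti-neg (suc L) F = trans (+-congˡ (anti-neg L (λ r → F (suc r))))
    (solve 2 (λ a b → :- a :+ :- b := :- (a :+ b)) refl _ _)

  anti-- : ∀ L F G → anti L (λ r s → F r s - G r s) ≈ anti L F - anti L G
  anti-- L F G = trans (anti-+ L F (λ r s → - G r s)) (+-congˡ (anti-neg L G))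

  anti-dropˡ : ∀ L F → (∀ s → F 0 s ≈ 0#) → anti (suc L) F ≈ anti L (λ r → F (suc r))
  anti-dropˡ L F F0≈0 = trans (+-congʳ (F0≈0 (suc L))) (+-identityˡ _)

  anti-dropʳ : ∀ L F → (∀ r → F r 0 ≈ 0#) → anti (suc L) F ≈ anti L (λ r s → F r (suc s))
  anti-dropʳ L F F0≈0 = trans (anti-last L F) (trans (+-congˡ (F0≈0 (suc L))) (+-identityʳ _))

-- Theta coefficients with an index of either sign

module Theta {c ℓ} (R : CommutativeRing c ℓ) (Q : CommutativeRing.Carrier R) where
  open CommutativeRing R
  open SemiringExp semiring
  open IntegerCoefficients R using (solve; _:=_; _:+_; _:*_; _:-_; :-_; con)
  open SetoidReasoning setoid

  -- (-1)^k Q^{k(k-1)/2} z^k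
  θ : Carrier → ℕ → Carrier
  θ z zero    = 1#
  θ z (suc k) = - (z * Q ^ k) * θ z k

  -- For z w = Q this is (-1)^k Q^{k(k-1)/2} z^k with k = r - N of either sign.
  ε : Carrier → Carrier → ℕ → ℕ → Carrier
  ε z w r       zero    = θ z r
  ε z w zero    (suc N) = θ w (suc N)
  ε z w (suc r) (suc N) = ε z w r N

  θ-cong : ∀ {z z′} → z ≈ z′ → ∀ k → θ z k ≈ θ z′ k
  θ-cong z≈z′ zero    = refl
  θ-cong z≈z′ (suc k) = *-cong (-‿cong (*-congʳ z≈z′)) (θ-cong z≈z′ k)

  ε-cong : ∀ {z z′ w w′} → z ≈ z′ → w ≈ w′ → ∀ r N → ε z w r N ≈ ε z′ w′ r N
  ε-cong z≈z′ w≈w′ r       zero    = θ-cong z≈z′ r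
  ε-cong z≈z′ w≈w′ zero    (suc N) = θ-cong w≈w′ (suc N)
  ε-cong z≈z′ w≈w′ (suc r) (suc N) = ε-cong z≈z′ w≈w′ r N

  ε-+ : ∀ z w k r N → ε z w (k ℕ.+ r) (k ℕ.+ N) ≡ ε z w r N
  ε-+ z w zero    r N = ≡.refl
  ε-+ z w (suc k) r N = ε-+ z w k r N

  ε-difference : ∀ z w a b {c d} → a ℕ.+ d ≡ c ℕ.+ b → ε z w a b ≡ ε z w c d
  ε-difference z w a zero {c} {d} eq rewrite ≡.trans (≡.sym (ℕ.+-identityʳ c)) (≡.sym eq) = ≡.sym (
    ≡.trans (≡.cong₂ (ε z w) (ℕ.+-comm a d) (≡.sym (ℕ.+-identityʳ d))) (ε-+ z w d a 0))
  ε-difference z w zero (suc b) {c} {d} eq rewrite eq = ≡.sym (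
    ≡.trans (≡.cong (λ a → ε z w a (c ℕ.+ suc b)) (≡.sym (ℕ.+-identityʳ c))) (ε-+ z w c 0 (suc b)))
  ε-difference z w (suc a) (suc b) {c} {d} eq =
    ε-difference z w a b (ℕ.suc-injective (≡.trans eq (ℕ.+-suc c b)))

  ε-mirror : ∀ z w r N → ε z w r N ≡ ε w z N r
  ε-mirror z w zero    zero    = ≡.refl
  ε-mirror z w (suc r) zero    = ≡.refl
  ε-mirror z w zero    (suc N) = ≡.refl
  ε-mirror z w (suc r) (suc N) = ε-mirror z w r N

  -- Since r - N = -(s - M), the index k becomes -k, and z and w = Q/z exchange their roles.
  ε-reverse : ∀ z w r s M N → r ℕ.+ s ≡ M ℕ.+ N → ε z w r N ≡ ε w z s M
  ε-reverse z w r s M N r+s≡M+N = ≡.trans (ε-mirror z w r N) (ε-difference w z N r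
    (≡.trans (ℕ.+-comm N M) (≡.trans (≡.sym r+s≡M+N) (ℕ.+-comm r s))))

  -- With k = r - N this is the recurrence ε_{k+1} = -z Q^k ε_k multiplied by Q^s, where k + s = M;
  -- the multiplication clears negative powers of Q. For k < 0 the recurrence rests on z w = Q.
  ε-step : ∀ {z w} → z * w ≈ Q → ∀ r {s} M N → r ℕ.+ s ≡ M ℕ.+ N →
           z * Q ^ M * ε z w r N ≈ - (Q ^ s * ε z w (suc r) N)
  ε-step {z} {w} zw≈Q r {s} M zero r+s≡M = begin
    z * Q ^ M * θ z r                  ≈⟨ *-congʳ (*-congˡ (^-congʳ Q (≡.trans (≡.sym (ℕ.+-identityʳ M)) (≡.sym r+s≡M)))) ⟩
    z * Q ^ (r ℕ.+ s) * θ z r          ≈⟨ *-congʳ (*-congˡ (^-homo-* Q r s)) ⟩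
    z * (Q ^ r * Q ^ s) * θ z r        ≈⟨ solve 4 (λ z a b t → z :* (a :* b) :* t := :- (b :* (:- (z :* a) :* t))) refl _ _ _ _ ⟩
    - (Q ^ s * (- (z * Q ^ r) * θ z r)) ∎
  ε-step {z} {w} zw≈Q zero {s} M (suc N) s≡M+N = begin
    z * Q ^ M * (- (w * Q ^ N) * θ w N)  ≈⟨ solve 5 (λ z w a b t → z :* a :* (:- (w :* b) :* t) := :- ((z :* w) :* (a :* b) :* t)) refl _ _ _ _ _ ⟩
    - ((z * w) * (Q ^ M * Q ^ N) * θ w N) ≈⟨ -‿cong (*-congʳ (*-cong zw≈Q (sym (^-homo-* Q M N)))) ⟩
    - (Q ^ suc (M ℕ.+ N) * θ w N)         ≈⟨ -‿cong (*-congʳ (^-congʳ Q (≡.sym (≡.trans s≡M+N (ℕ.+-suc M N))))) ⟩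
    - (Q ^ s * θ w N)                     ≡⟨ ≡.cong (λ e → - (Q ^ s * e)) (lemma N) ⟨
    - (Q ^ s * ε z w 0 N)                 ∎
    where
    lemma : ∀ N → ε z w 0 N ≡ θ w N
    lemma zero    = ≡.refl
    lemma (suc N) = ≡.refl
  ε-step zw≈Q (suc r) M (suc N) eq = ε-step zw≈Q r M N (ℕ.suc-injective (≡.trans eq (ℕ.+-suc M N)))

  θ-scale : ∀ x z k → θ (x * z) k ≈ x ^ k * θ z k
  θ-scale x z zero    = sym (*-identityˡ 1#)
  θ-scale x z (suc k) = trans (*-congˡ (θ-scale x z k))
    (solve 5 (λ x z a b t → :- (x :* z :* a) :* (b :* t) := (x :* b) :* (:- (z :* a) :* t)) refl _ _ _ _ _)

  -- Moving a factor x from `w` to `z` multiplies the term of index k by x^k = x^(r-N); the negative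
  -- power is cleared.
  ε-scaleˡ : ∀ x z w r N → x ^ N * ε (x * z) w r N ≈ x ^ r * ε z (x * w) r N
  ε-scaleˡ x z w r       zero    = trans (*-identityˡ _) (θ-scale x z r)
  ε-scaleˡ x z w zero    (suc N) = trans (sym (θ-scale x w (suc N))) (sym (*-identityˡ _))
  ε-scaleˡ x z w (suc r) (suc N) = begin
    (x * x ^ N) * ε (x * z) w r N    ≈⟨ *-assoc _ _ _ ⟩
    x * (x ^ N * ε (x * z) w r N)    ≈⟨ *-congˡ (ε-scaleˡ x z w r N) ⟩
    x * (x ^ r * ε z (x * w) r N)    ≈⟨ *-assoc _ _ _ ⟨
    (x * x ^ r) * ε z (x * w) r N    ∎

  ε-scaleʳ : ∀ x z w r s N → r ℕ.+ s ≡ N ℕ.+ N → x ^ N * ε z (x * w) r N ≈ x ^ s * ε (x * z) w r N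
  ε-scaleʳ x z w r s N r+s≡N+N = begin
    x ^ N * ε z (x * w) r N   ≡⟨ ≡.cong (x ^ N *_) (ε-reverse z (x * w) r s N N r+s≡N+N) ⟩
    x ^ N * ε (x * w) z s N   ≈⟨ ε-scaleˡ x w z s N ⟩
    x ^ s * ε w (x * z) s N   ≡⟨ ≡.cong (x ^ s *_) (ε-reverse (x * z) w r s N N r+s≡N+N) ⟨
    x ^ s * ε (x * z) w r N   ∎

  θ-reflect : ∀ k → θ 1# (suc k) ≈ - θ Q k
  θ-reflect zero    = solve 0 (:- (con (+ 1) :* con (+ 1)) :* con (+ 1) := :- con (+ 1)) refl
  θ-reflect (suc k) = trans (*-congˡ (θ-reflect k))
    (solve 3 (λ Q a t → :- (con (+ 1) :* (Q :* a)) :* (:- t) := :- (:- (Q :* a) :* t)) refl _ _ _)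

  -- For z = 1 the exponent k(k-1)/2 is invariant under k ↦ 1 - k while (-1)^k changes sign; the two
  -- indices r + 1 - N and N - r have sum 1.
  ε-reflect : ∀ r N → ε 1# Q (suc r) N ≈ - ε 1# Q N r
  ε-reflect zero    zero    = θ-reflect 0
  ε-reflect (suc r) zero    = θ-reflect (suc r)
  ε-reflect zero    (suc N) = begin
    ε 1# Q 0 N         ≡⟨ ≡.trans (ε-mirror 1# Q 0 N) ≡.refl ⟩
    θ Q N              ≈⟨ solve 1 (λ t → t := :- (:- t)) refl _ ⟩
    - (- θ Q N)        ≈⟨ -‿cong (θ-reflect N) ⟨
    - θ 1# (suc N)     ∎
  ε-reflect (suc r) (suc N) = ε-reflect r N

module _ {c ℓ} (R : CommutativeRing c ℓ) where
  open CommutativeRing R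
  open SemiringExp semiring

  PowerInverses : Carrier → (ℕ → Carrier) → Set ℓ
  PowerInverses q inv = ∀ k → inv k * (1# - q ^ suc k) ≈ 1#

  -- Makes a sum vanish once a reflection of its index shows that it equals its own negative.
  TorsionFree : Set (c ⊔ ℓ)
  TorsionFree = ∀ y → y + y ≈ 0# → y ≈ 0#

-- Bilateral sums and their contiguous relations

module BilateralSum {c ℓ} (R : CommutativeRing c ℓ)
  (q : CommutativeRing.Carrier R) (inv : ℕ → CommutativeRing.Carrier R) (inv-inverse : PowerInverses R q inv)
  (Q : CommutativeRing.Carrier R)
  where
  open CommutativeRing R
  open SemiringExp semiring
  open IntegerCoefficients R using (solve; _:=_; _:+_; _:*_; _:-_; :-_; con)
  open AntidiagonalSum R
  open Theta R Q
  open SetoidReasoning setoid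

  -- 1/(q;q)_r
  u : ℕ → Carrier
  u zero    = 1#
  u (suc r) = inv r * u r

  u-zero : u 0 * (1# - q ^ 0) ≈ 0#
  u-zero = solve 0 (con (+ 1) :* (con (+ 1) :- con (+ 1)) := con (+ 0)) refl

  u-suc : ∀ r → u (suc r) * (1# - q ^ suc r) ≈ u r
  u-suc r = begin
    inv r * u r * (1# - q ^ suc r)     ≈⟨ solve 3 (λ a b c → a :* b :* c := a :* c :* b) refl _ _ _ ⟩
    inv r * (1# - q ^ suc r) * u r     ≈⟨ *-congʳ (inv-inverse r) ⟩
    1# * u r                           ≈⟨ *-identityˡ _ ⟩
    u r                                ∎

  -- For z w = Q this is the sum over -N ≤ k ≤ M of (-1)^k Q^{k(k-1)/2} z^k / ((q;q)_{N+k}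
  -- (q;q)_{M-k}). The base q of the denominators is independent of Q: base q serves the transfer
  -- iterates, base Q the triple product.
  J : Carrier → Carrier → ℕ → ℕ → Carrier
  J z w M N = anti (M ℕ.+ N) (λ r s → u r * u s * ε z w r N)

  J-cong : ∀ {z z′ w w′} → z ≈ z′ → w ≈ w′ → ∀ M N → J z w M N ≈ J z′ w′ M N
  J-cong z≈z′ w≈w′ M N = anti-cong (M ℕ.+ N) λ r s _ → *-congˡ (ε-cong z≈z′ w≈w′ r N)

  J-mirror : ∀ z w M N → J z w M N ≈ J w z N M
  J-mirror z w M N = begin
    anti (M ℕ.+ N) (λ r s → u r * u s * ε z w r N)   ≈⟨ anti-flip (M ℕ.+ N) _ ⟩
    anti (M ℕ.+ N) (λ r s → u s * u r * ε z w s N)   ≈⟨ anti-cong (M ℕ.+ N) (λ r s r+s≡ → *-cong (*-comm _ _)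
                                                          (reflexive (ε-reverse z w s r M N (≡.trans (ℕ.+-comm s r) r+s≡)))) ⟩
    anti (M ℕ.+ N) (λ r s → u r * u s * ε w z r M)   ≡⟨ ≡.cong (λ L → anti L (λ r s → u r * u s * ε w z r M)) (ℕ.+-comm M N) ⟩
    anti (N ℕ.+ M) (λ r s → u r * u s * ε w z r M)   ∎

  ^-split : ∀ r s {L} → r ℕ.+ s ≡ L → q ^ L ≈ q ^ r * q ^ s
  ^-split r s r+s≡L = trans (^-congʳ q (≡.sym r+s≡L)) (^-homo-* q r s)

  -- Moving a factor q between the two arguments multiplies a term by q^k or q^(-k), where r = N + 1
  -- + k and s = N + 1 - k. Hence x turns the two neighbours into q^s and q^r times the middle term,
  -- and as x^2 = q^(r+s), the left side gains the factor (1 - q^r)(1 - q^s), which lowers the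
  -- indices of both `u r` and `u s`.
  J-interior : ∀ z w N → let x = q ^ suc N in
    (1# + x * x) * J (q * z) (q * w) (suc N) (suc N)
      - (x * J z (q * (q * w)) (suc N) (suc N) + x * J (q * (q * z)) w (suc N) (suc N))
    ≈ J (q * z) (q * w) N N
  J-interior z w N = begin
    (1# + x * x) * anti L F - (x * anti L F₋ + x * anti L F₊)
      ≈⟨ +-cong (anti-* L _ F) (-‿cong (+-cong (anti-* L x F₋) (anti-* L x F₊))) ⟨
    anti L (λ r s → (1# + x * x) * F r s) - (anti L (λ r s → x * F₋ r s) + anti L (λ r s → x * F₊ r s))
      ≈⟨ +-congˡ (-‿cong (anti-+ L (λ r s → x * F₋ r s) (λ r s → x * F₊ r s))) ⟨
    anti L (λ r s → (1# + x * x) * F r s) - anti L (λ r s → x * F₋ r s + x * F₊ r s)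
      ≈⟨ anti-- L (λ r s → (1# + x * x) * F r s) (λ r s → x * F₋ r s + x * F₊ r s) ⟨
    anti L (λ r s → (1# + x * x) * F r s - (x * F₋ r s + x * F₊ r s))
      ≈⟨ anti-cong L term ⟩
    anti L G
      -- The end terms r = 0 and s = 0 vanish. Shifting both indices leaves k unchanged, so `ε` at
      -- `suc N` reduces to `ε` at `N`.
      ≈⟨ anti-dropˡ (N ℕ.+ suc N) G (λ s → trans (*-congʳ (trans (*-congʳ u-zero) (zeroˡ _))) (zeroˡ _)) ⟩
    anti (N ℕ.+ suc N) (λ r → G (suc r))
      ≡⟨ ≡.cong (λ K → anti K (λ r → G (suc r))) (ℕ.+-suc N N) ⟩
    anti (suc (N ℕ.+ N)) (λ r → G (suc r))
      ≈⟨ anti-dropʳ (N ℕ.+ N) (λ r → G (suc r)) (λ r → trans (*-congʳ (trans (*-congˡ u-zero) (zeroʳ _))) (zeroˡ _)) ⟩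
    anti (N ℕ.+ N) (λ r s → G (suc r) (suc s))
      ≈⟨ anti-cong (N ℕ.+ N) (λ r s _ → *-congʳ (*-cong (u-suc r) (u-suc s))) ⟩
    J (q * z) (q * w) N N ∎
    where
    x = q ^ suc N
    L = suc N ℕ.+ suc N
    F F₋ F₊ G : ℕ → ℕ → Carrier
    F  r s = u r * u s * ε (q * z) (q * w) r (suc N)
    F₋ r s = u r * u s * ε z (q * (q * w)) r (suc N)
    F₊ r s = u r * u s * ε (q * (q * z)) w r (suc N)
    G  r s = (u r * (1# - q ^ r)) * (u s * (1# - q ^ s)) * ε (q * z) (q * w) r (suc N)
    term : ∀ r s → r ℕ.+ s ≡ L → (1# + x * x) * F r s - (x * F₋ r s + x * F₊ r s) ≈ G r s
    term r s r+s≡L = begin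
      (1# + x * x) * (a * b * e) - (x * (a * b * e₋) + x * (a * b * e₊))
        ≈⟨ solve 6 (λ x a b e e₋ e₊ → (con (+ 1) :+ x :* x) :* (a :* b :* e) :- (x :* (a :* b :* e₋) :+ x :* (a :* b :* e₊))
                      := a :* b :* ((con (+ 1) :+ x :* x) :* e :- (x :* e₋ :+ x :* e₊))) refl _ _ _ _ _ _ ⟩
      a * b * ((1# + x * x) * e - (x * e₋ + x * e₊))
        ≈⟨ *-congˡ (+-cong (*-congʳ (+-congˡ (trans (sym (^-homo-* q (suc N) (suc N))) (^-split r s r+s≡L))))
             (-‿cong (+-cong (ε-scaleʳ q z (q * w) r s (suc N) r+s≡L) (ε-scaleˡ q (q * z) w r (suc N))))) ⟩
      a * b * ((1# + q ^ r * q ^ s) * e - (q ^ s * e + q ^ r * e))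
        ≈⟨ solve 5 (λ a b c d e → a :* b :* ((con (+ 1) :+ c :* d) :* e :- (d :* e :+ c :* e))
                      := a :* (con (+ 1) :- c) :* (b :* (con (+ 1) :- d)) :* e) refl _ _ _ _ _ ⟩
      G r s ∎
      where
      a = u r
      b = u s
      e  = ε (q * z) (q * w) r (suc N)
      e₋ = ε z (q * (q * w)) r (suc N)
      e₊ = ε (q * (q * z)) w r (suc N)

  -- Here k ↦ 1 - k reverses the signs of the terms of the difference of the two sides.
  J-boundary : TorsionFree R → ∀ w → q * w ≈ Q → ∀ N →
    J 1# Q (suc N) (suc N) ≈ q ^ suc N * J (q * 1#) w (suc N) (suc N)
  J-boundary torsion-free w qw≈Q N = begin
    J 1# Q (suc N) (suc N)
      ≈⟨ solve 2 (λ a b → a := (a :- b) :+ b) refl _ _ ⟩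
    (J 1# Q (suc N) (suc N) - x * J (q * 1#) w (suc N) (suc N)) + x * J (q * 1#) w (suc N) (suc N)
      ≈⟨ +-congʳ difference ⟩
    0# + x * J (q * 1#) w (suc N) (suc N)
      ≈⟨ +-identityˡ _ ⟩
    x * J (q * 1#) w (suc N) (suc N) ∎
    where
    x = q ^ suc N
    L = N ℕ.+ suc N
    F F₊ G H : ℕ → ℕ → Carrier
    F  r s = u r * u s * ε 1# Q r (suc N)
    F₊ r s = u r * u s * ε (q * 1#) w r (suc N)
    G  r s = u r * (1# - q ^ r) * u s * ε 1# Q r (suc N)
    H  r s = u r * u s * ε 1# Q (suc r) (suc N)

    term : ∀ r s → F r s - x * F₊ r s ≈ G r s
    term r s = begin
      a * b * e - x * (a * b * e₊)   ≈⟨ solve 5 (λ x a b e e₊ → a :* b :* e :- x :* (a :* b :* e₊) := a :* b :* (e :- x :* e₊)) refl _ _ _ _ _ ⟩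
      a * b * (e - x * e₊)           ≈⟨ *-congˡ (+-congˡ (-‿cong (trans (ε-scaleˡ q 1# w r (suc N)) (*-congˡ (ε-cong refl qw≈Q r (suc N)))))) ⟩
      a * b * (e - q ^ r * e)        ≈⟨ solve 4 (λ a b c e → a :* b :* (e :- c :* e) := a :* (con (+ 1) :- c) :* b :* e) refl _ _ _ _ ⟩
      G r s                          ∎
      where
      a = u r
      b = u s
      e  = ε 1# Q r (suc N)
      e₊ = ε (q * 1#) w r (suc N)

    -- With r + s = 2N + 1 and k = r - N, exchanging r and s is k ↦ 1 - k. Absorbing the factor 1 -
    -- q^r into `u` has made the denominators symmetric under this exchange.
    antisymmetric : ∀ r s → r ℕ.+ s ≡ L → H r s ≈ - H s r
    antisymmetric r s r+s≡L = begin
      u r * u s * ε 1# Q (suc r) (suc N)     ≈⟨ *-congˡ (ε-reflect r (suc N)) ⟩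
      u r * u s * - ε 1# Q (suc N) r         ≡⟨ ≡.cong (λ e → u r * u s * - e) (ε-difference 1# Q (suc N) r
                                                (≡.cong suc (≡.trans (≡.sym r+s≡L) (ℕ.+-comm r s)))) ⟩
      u r * u s * - ε 1# Q (suc s) (suc N)   ≈⟨ solve 3 (λ a b e → a :* b :* (:- e) := :- (b :* a :* e)) refl _ _ _ ⟩
      - H s r                                ∎

    difference : J 1# Q (suc N) (suc N) - x * J (q * 1#) w (suc N) (suc N) ≈ 0#
    difference = begin
      anti (suc L) F - x * anti (suc L) F₊                 ≈⟨ +-congˡ (-‿cong (anti-* (suc L) x F₊)) ⟨
      anti (suc L) F - anti (suc L) (λ r s → x * F₊ r s)   ≈⟨ anti-- (suc L) F (λ r s → x * F₊ r s) ⟨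
      anti (suc L) (λ r s → F r s - x * F₊ r s)            ≈⟨ anti-cong (suc L) (λ r s _ → term r s) ⟩
      anti (suc L) G                                       ≈⟨ anti-dropˡ L G (λ s → trans (*-congʳ (trans (*-congʳ u-zero) (zeroˡ _))) (zeroˡ _)) ⟩
      anti L (λ r → G (suc r))                             ≈⟨ anti-cong L (λ r s _ → *-congʳ (*-congʳ (u-suc r))) ⟩
      anti L H                                             ≈⟨ torsion-free _ doubled ⟩
      0#                                                   ∎
      where
      doubled : anti L H + anti L H ≈ 0#
      doubled = begin
        anti L H + anti L H                        ≈⟨ +-congˡ (anti-cong L antisymmetric) ⟩
        anti L H + anti L (λ r s → - H s r)        ≈⟨ +-congˡ (anti-neg L (λ r s → H s r)) ⟩
        anti L H - anti L (λ r s → H s r)          ≈⟨ +-congˡ (-‿cong (anti-flip L H)) ⟨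
        anti L H - anti L H                        ≈⟨ -‿inverseʳ _ ⟩
        0#                                         ∎

module Pochhammer {c ℓ} (R : CommutativeRing c ℓ) where
  open CommutativeRing R
  open SemiringExp semiring

  pochhammer : Carrier → Carrier → ℕ → Carrier
  pochhammer a x zero    = 1#
  pochhammer a x (suc N) = pochhammer a x N * (1# - a * x ^ N)

-- The finite Jacobi triple product

module FiniteTripleProduct {c ℓ} (R : CommutativeRing c ℓ)
  (Q : CommutativeRing.Carrier R) (inv : ℕ → CommutativeRing.Carrier R) (inv-inverse : PowerInverses R Q inv)
  where
  open CommutativeRing R
  open SemiringExp semiring
  open IntegerCoefficients R using (solve; _:=_; _:+_; _:*_; _:-_; :-_; con)
  open AntidiagonalSum R
  open Theta R Q
  open BilateralSum R Q inv inv-inverse Q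
  open Pochhammer R
  open SetoidReasoning setoid

  -- The q-Pascal rule: 1 - Q^(r+s) = (1 - Q^s) + Q^s (1 - Q^r) splits the sum into two sums of
  -- length M + N, one of them with k shifted by one; `ε-step` recombines them into the factor 1 - z
  -- Q^M.
  J-step : ∀ {z w} → z * w ≈ Q → ∀ M N →
           (1# - Q ^ suc (M ℕ.+ N)) * J z w (suc M) N ≈ (1# - z * Q ^ M) * J z w M N
  J-step {z} {w} zw≈Q M N = begin
    (1# - Q ^ suc L) * anti (suc L) F        ≈⟨ anti-* (suc L) (1# - Q ^ suc L) F ⟨
    anti (suc L) (λ r s → (1# - Q ^ suc L) * F r s)
      ≈⟨ anti-cong (suc L) pascal ⟩
    anti (suc L) (λ r s → G r s + H r s)     ≈⟨ anti-+ (suc L) G H ⟩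
    anti (suc L) G + anti (suc L) H
      ≈⟨ +-cong (anti-dropʳ L G λ r → trans (*-congʳ (trans (*-congˡ u-zero) (zeroʳ _))) (zeroˡ _))
                (anti-dropˡ L H λ s → trans (*-congʳ (trans (*-congʳ (trans (*-congˡ u-zero) (zeroʳ _))) (zeroˡ _))) (zeroˡ _)) ⟩
    anti L (λ r s → G r (suc s)) + anti L (λ r → H (suc r))
      ≈⟨ anti-+ L (λ r s → G r (suc s)) (λ r → H (suc r)) ⟨
    anti L (λ r s → G r (suc s) + H (suc r) s)
      ≈⟨ anti-cong L recombine ⟩
    anti L (λ r s → (1# - z * Q ^ M) * F r s)
      ≈⟨ anti-* L (1# - z * Q ^ M) F ⟩
    (1# - z * Q ^ M) * anti L F              ∎
    where
    L = M ℕ.+ N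
    F G H : ℕ → ℕ → Carrier
    F r s = u r * u s * ε z w r N
    G r s = u r * (u s * (1# - Q ^ s)) * ε z w r N
    H r s = Q ^ s * (u r * (1# - Q ^ r)) * u s * ε z w r N

    pascal : ∀ r s → r ℕ.+ s ≡ suc L → (1# - Q ^ suc L) * F r s ≈ G r s + H r s
    pascal r s r+s≡ = trans (*-congʳ (+-congˡ (-‿cong (^-split r s r+s≡))))
      (solve 5 (λ x y a b e → (con (+ 1) :- x :* y) :* (a :* b :* e)
        := a :* (b :* (con (+ 1) :- y)) :* e :+ y :* (a :* (con (+ 1) :- x)) :* b :* e) refl _ _ _ _ _)

    recombine : ∀ r s → r ℕ.+ s ≡ L → G r (suc s) + H (suc r) s ≈ (1# - z * Q ^ M) * F r s
    recombine r s r+s≡ = begin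
      G r (suc s) + H (suc r) s
        ≈⟨ +-cong (*-congʳ (*-congˡ (u-suc s))) (*-congʳ (*-congʳ (*-congˡ (u-suc r)))) ⟩
      u r * u s * ε z w r N + Q ^ s * u r * u s * ε z w (suc r) N
        ≈⟨ solve 5 (λ a b e y e₊ → a :* b :* e :+ y :* a :* b :* e₊ := a :* b :* (e :- :- (y :* e₊))) refl _ _ _ _ _ ⟩
      u r * u s * (ε z w r N - - (Q ^ s * ε z w (suc r) N))
        ≈⟨ *-congˡ (+-congˡ (-‿cong (ε-step zw≈Q r M N r+s≡))) ⟨
      u r * u s * (ε z w r N - z * Q ^ M * ε z w r N)
        ≈⟨ solve 5 (λ a b e z x → a :* b :* (e :- z :* x :* e) := (con (+ 1) :- z :* x) :* (a :* b :* e)) refl _ _ _ _ _ ⟩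
      (1# - z * Q ^ M) * F r s ∎

  -- Independent bounds `M` and `N` let the induction add one factor at a time; factors in `w` are
  -- obtained from those in `z` by `J-mirror`.
  J-product : ∀ {z w} → z * w ≈ Q → ∀ M N →
              pochhammer Q Q (M ℕ.+ N) * J z w M N ≈ pochhammer z Q M * pochhammer w Q N
  J-product zw≈Q zero zero = solve 0 (con (+ 1) :* (con (+ 1) :* con (+ 1) :* con (+ 1)) := con (+ 1) :* con (+ 1)) refl
  J-product {z} {w} zw≈Q (suc M) N = begin
    pochhammer Q Q (M ℕ.+ N) * (1# - Q ^ suc (M ℕ.+ N)) * J z w (suc M) N    ≈⟨ *-assoc _ _ _ ⟩
    pochhammer Q Q (M ℕ.+ N) * ((1# - Q ^ suc (M ℕ.+ N)) * J z w (suc M) N)  ≈⟨ *-congˡ (J-step zw≈Q M N) ⟩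
    pochhammer Q Q (M ℕ.+ N) * ((1# - z * Q ^ M) * J z w M N)
      ≈⟨ solve 3 (λ a b c → a :* (b :* c) := a :* c :* b) refl _ _ _ ⟩
    pochhammer Q Q (M ℕ.+ N) * J z w M N * (1# - z * Q ^ M)                  ≈⟨ *-congʳ (J-product zw≈Q M N) ⟩
    pochhammer z Q M * pochhammer w Q N * (1# - z * Q ^ M)
      ≈⟨ solve 3 (λ a b c → a :* b :* c := a :* c :* b) refl _ _ _ ⟩
    pochhammer z Q (suc M) * pochhammer w Q N                                ∎
  J-product {z} {w} zw≈Q zero (suc N) = begin
    pochhammer Q Q N * (1# - Q ^ suc N) * J z w 0 (suc N)
      ≈⟨ *-cong (*-congˡ (+-congˡ (-‿cong (^-congʳ Q (≡.cong suc (≡.sym (ℕ.+-identityʳ N))))))) (J-mirror z w 0 (suc N)) ⟩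
    pochhammer Q Q N * (1# - Q ^ suc (N ℕ.+ 0)) * J w z (suc N) 0            ≈⟨ *-assoc _ _ _ ⟩
    pochhammer Q Q N * ((1# - Q ^ suc (N ℕ.+ 0)) * J w z (suc N) 0)          ≈⟨ *-congˡ (J-step (trans (*-comm w z) zw≈Q) N 0) ⟩
    pochhammer Q Q N * ((1# - w * Q ^ N) * J w z N 0)                        ≈⟨ *-congˡ (*-congˡ (J-mirror w z N 0)) ⟩
    pochhammer Q Q N * ((1# - w * Q ^ N) * J z w 0 N)
      ≈⟨ solve 3 (λ a b c → a :* (b :* c) := a :* c :* b) refl _ _ _ ⟩
    pochhammer Q Q N * J z w 0 N * (1# - w * Q ^ N)                          ≈⟨ *-congʳ (J-product zw≈Q 0 N) ⟩
    1# * pochhammer w Q N * (1# - w * Q ^ N)                                 ≈⟨ *-assoc _ _ _ ⟩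
    1# * pochhammer w Q (suc N)                                              ∎

-- Stabilisation of the bilateral sum

module StableRange {c ℓ} (R : CommutativeRing c ℓ)
  (q : CommutativeRing.Carrier R) (inv : ℕ → CommutativeRing.Carrier R) (inv-inverse : PowerInverses R q inv)
  (Q : CommutativeRing.Carrier R) (m : ℕ)
  where
  open CommutativeRing R
  open SemiringExp semiring
  open AntidiagonalSum R
  open Theta R Q
  open BilateralSum R q inv inv-inverse Q
  open SetoidReasoning setoid

  -- If r ≤ m, then k = r - N ≤ -(m + 1) because N = 2m + 1, so the term contains a vanishing value
  -- of `θ w`; s ≤ m is the mirror image. In the remaining terms both denominators are stable.
  J-stable : ∀ u∞ → (∀ r → m ℕ.< r → u r ≈ u∞) →
             ∀ z w → (∀ k → m ℕ.< k → θ z k ≈ 0#) → (∀ k → m ℕ.< k → θ w k ≈ 0#) →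
             let N = suc (m ℕ.+ m) in J z w N N ≈ u∞ * u∞ * anti (N ℕ.+ N) (λ r s → ε z w r N)
  J-stable u∞ u≈u∞ z w θz≈0 θw≈0 = trans (anti-cong (N ℕ.+ N) term) (anti-* (N ℕ.+ N) (u∞ * u∞) (λ r s → ε z w r N))
    where
    N = suc (m ℕ.+ m)

    vanish : ∀ z w → (∀ k → m ℕ.< k → θ w k ≈ 0#) → ∀ r → r ℕ.≤ m → ε z w r N ≈ 0#
    vanish z w θw≈0 r r≤m = trans
      (reflexive (ε-difference z w r N {0} {N ∸ r} (ℕ.m+[n∸m]≡n (ℕ.≤-trans r≤m (ℕ.≤-trans (ℕ.m≤m+n m m) (ℕ.n≤1+n _))))))
      (trans (reflexive (ε-mirror z w 0 (N ∸ r))) (θw≈0 (N ∸ r) (ℕ.≤-trans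
        (ℕ.≤-reflexive (≡.sym (ℕ.m+n∸n≡m (suc m) m))) (ℕ.∸-monoʳ-≤ N r≤m))))

    both-zero : ∀ {a b e} → e ≈ 0# → a * e ≈ b * e
    both-zero e≈0 = trans (*-congˡ e≈0) (trans (zeroʳ _) (sym (trans (*-congˡ e≈0) (zeroʳ _))))

    term : ∀ r s → r ℕ.+ s ≡ N ℕ.+ N → u r * u s * ε z w r N ≈ u∞ * u∞ * ε z w r N
    term r s r+s≡ with r ℕ.≤? m | s ℕ.≤? m
    ... | yes r≤m | _       = both-zero (vanish z w θw≈0 r r≤m)
    ... | no  r≰m | yes s≤m = both-zero (trans (reflexive (ε-reverse z w r s N N r+s≡)) (vanish w z θz≈0 s s≤m))
    ... | no  r≰m | no  s≰m = *-congʳ (*-cong (u≈u∞ r (ℕ.≰⇒> r≰m)) (u≈u∞ s (ℕ.≰⇒> s≰m)))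

-- Inversion of the matrix x^|u-v|

module Transfer {c ℓ} (R : CommutativeRing c ℓ) where
  open CommutativeRing R
  open SemiringExp semiring
  open SemiringSum semiring using (sum; sum-cong-≋; *-distribˡ-sum)
  open IntegerCoefficients R using (solve; _:=_; _:+_; _:*_; _:-_; :-_; con)
  open SetoidReasoning setoid

  transfer : Carrier → ℕ → (ℕ → Carrier) → ℕ → Carrier
  transfer x n f v = sum {suc n} λ i → f (toℕ i) * x ^ ∣ toℕ i - v ∣

  module _ (x : Carrier) where

    -- g, with indices shifted by one, solves the tridiagonal system inverse to the transfer.
    Interior : ℕ → (ℕ → Carrier) → (ℕ → Carrier) → Set ℓ
    Interior n f g = ∀ i → i ℕ.≤ n → (1# - x * x) * f i ≈ (1# + x * x) * g (suc i) - (x * g i + x * g (suc (suc i)))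

    -- Seen from colour 0 the sum is a polynomial in x, and the Horner step f 0 + x (...) telescopes
    -- against the tridiagonal system.
    transfer-zero : ∀ n f g → Interior n f g → g (suc (suc n)) ≈ x * g (suc n) →
                    (1# - x * x) * transfer x n f 0 ≈ g 1 - x * g 0
    transfer-zero zero f g interior boundary = begin
      (1# - x * x) * (f 0 * 1# + 0#)
        ≈⟨ solve 2 (λ a b → a :* (b :* con (+ 1) :+ con (+ 0)) := a :* b) refl _ _ ⟩
      (1# - x * x) * f 0
        ≈⟨ interior 0 ℕ.z≤n ⟩
      (1# + x * x) * g 1 - (x * g 0 + x * g 2)
        ≈⟨ +-congˡ (-‿cong (+-congˡ (*-congˡ boundary))) ⟩
      (1# + x * x) * g 1 - (x * g 0 + x * (x * g 1))
        ≈⟨ solve 3 (λ x a b → (con (+ 1) :+ x :* x) :* b :- (x :* a :+ x :* (x :* b)) := b :- x :* a) refl _ _ _ ⟩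
      g 1 - x * g 0 ∎
    transfer-zero (suc n) f g interior boundary = begin
      (1# - x * x) * (f 0 * 1# + sum {suc n} (λ i → f (suc (toℕ i)) * (x * x ^ toℕ i)))
        ≈⟨ *-congˡ (+-cong (*-identityʳ _) (trans (sum-cong-≋ {suc n} λ i → trans
             (solve 3 (λ a x b → a :* (x :* b) := x :* (a :* b)) refl (f (suc (toℕ i))) x (x ^ toℕ i))
             (*-congˡ (*-congˡ (^-congʳ x (≡.sym (ℕ.∣-∣-identityʳ (toℕ i)))))))
             (sym (*-distribˡ-sum {suc n} x (λ i → f (suc (toℕ i)) * x ^ ∣ toℕ i - 0 ∣))))) ⟩
      (1# - x * x) * (f 0 + x * transfer x n (λ i → f (suc i)) 0)
        ≈⟨ solve 4 (λ y f x s → y :* (f :+ x :* s) := y :* f :+ x :* (y :* s)) refl _ _ _ _ ⟩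
      (1# - x * x) * f 0 + x * ((1# - x * x) * transfer x n (λ i → f (suc i)) 0)
        ≈⟨ +-cong (interior 0 ℕ.z≤n) (*-congˡ (transfer-zero n (λ i → f (suc i)) (λ i → g (suc i))
             (λ i i≤n → interior (suc i) (ℕ.s≤s i≤n)) boundary)) ⟩
      (1# + x * x) * g 1 - (x * g 0 + x * g 2) + x * (g 2 - x * g 1)
        ≈⟨ solve 4 (λ x a b c → (con (+ 1) :+ x :* x) :* b :- (x :* a :+ x :* c) :+ x :* (c :- x :* b) := b :- x :* a) refl _ _ _ _ ⟩
      g 1 - x * g 0 ∎

    -- The left boundary equation is not assumed, since it is lost when the induction removes colour
    -- 0; its defect `g 0 - x * g 1` is carried along and decays like x^(v+1).
    transfer-general : ∀ n v → v ℕ.≤ n → ∀ f g → Interior n f g → g (suc (suc n)) ≈ x * g (suc n) →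
                       (1# - x * x) * transfer x n f v ≈ (1# - x * x) * g (suc v) - x ^ suc v * (g 0 - x * g 1)
    transfer-general n zero v≤n f g interior boundary = trans (transfer-zero n f g interior boundary)
      (solve 3 (λ x a b → b :- x :* a := (con (+ 1) :- x :* x) :* b :- x :* con (+ 1) :* (a :- x :* b)) refl _ _ _)
    transfer-general (suc n) (suc v) (ℕ.s≤s v≤n) f g interior boundary = begin
      (1# - x * x) * (f 0 * (x * x ^ v) + transfer x n (λ i → f (suc i)) v)
        ≈⟨ solve 4 (λ y f z s → y :* (f :* z :+ s) := z :* (y :* f) :+ y :* s) refl _ _ _ _ ⟩
      x * x ^ v * ((1# - x * x) * f 0) + (1# - x * x) * transfer x n (λ i → f (suc i)) v
        ≈⟨ +-cong (*-congˡ (interior 0 ℕ.z≤n)) (transfer-general n v v≤n (λ i → f (suc i)) (λ i → g (suc i))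
             (λ i i≤n → interior (suc i) (ℕ.s≤s i≤n)) boundary) ⟩
      x * x ^ v * ((1# + x * x) * g 1 - (x * g 0 + x * g 2)) + ((1# - x * x) * g (suc (suc v)) - x * x ^ v * (g 1 - x * g 2))
        ≈⟨ solve 6 (λ x y a b c d → x :* y :* ((con (+ 1) :+ x :* x) :* b :- (x :* a :+ x :* c)) :+ ((con (+ 1) :- x :* x) :* d :- x :* y :* (b :- x :* c))
                      := (con (+ 1) :- x :* x) :* d :- x :* (x :* y) :* (a :- x :* b)) refl _ _ _ _ _ _ ⟩
      (1# - x * x) * g (suc (suc v)) - x ^ suc (suc v) * (g 0 - x * g 1) ∎

    transfer-solution : ∀ n v → v ℕ.≤ n → ∀ f g → Interior n f g → g 0 ≈ x * g 1 → g (suc (suc n)) ≈ x * g (suc n) →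
                        (1# - x * x) * transfer x n f v ≈ (1# - x * x) * g (suc v)
    transfer-solution n v v≤n f g interior left right = begin
      (1# - x * x) * transfer x n f v                                   ≈⟨ transfer-general n v v≤n f g interior right ⟩
      (1# - x * x) * g (suc v) - x ^ suc v * (g 0 - x * g 1)            ≈⟨ +-congˡ (-‿cong (*-congˡ (+-congʳ left))) ⟩
      (1# - x * x) * g (suc v) - x ^ suc v * (x * g 1 - x * g 1)        ≈⟨ solve 3 (λ a b c → a :- b :* (c :- c) := a) refl _ _ _ ⟩
      (1# - x * x) * g (suc v)                                          ∎

-- Closed form of the iterated transfer

module TransferIterates {c ℓ} (R : CommutativeRing c ℓ)
  (torsion-free : TorsionFree R)
  (q : CommutativeRing.Carrier R) (inv : ℕ → CommutativeRing.Carrier R) (inv-inverse : PowerInverses R q inv)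
  (n : ℕ)
  where
  open CommutativeRing R
  open SemiringExp semiring
  open IntegerCoefficients R using (solve; _:=_; _:+_; _:*_; _:-_; :-_; con)
  open SemiringSum semiring using (sum-cong-≋)
  Q : Carrier
  Q = q ^ suc (suc n)
  open BilateralSum R q inv inv-inverse Q
  open Transfer R
  open Pochhammer R
  open SetoidReasoning setoid

  iterate : ℕ → ℕ → Carrier
  iterate zero    v = 1#
  iterate (suc N) v = transfer (q ^ suc N) n (iterate N) v

  cancelˡ : ∀ k {a b} → (1# - q ^ suc k) * a ≈ (1# - q ^ suc k) * b → a ≈ b
  cancelˡ k {a} {b} eq = begin
    a                                    ≈⟨ *-identityˡ a ⟨
    1# * a                               ≈⟨ *-congʳ (inv-inverse k) ⟨
    inv k * (1# - q ^ suc k) * a         ≈⟨ *-assoc _ _ _ ⟩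
    inv k * ((1# - q ^ suc k) * a)       ≈⟨ *-congˡ eq ⟩
    inv k * ((1# - q ^ suc k) * b)       ≈⟨ *-assoc _ _ _ ⟨
    inv k * (1# - q ^ suc k) * b         ≈⟨ *-congʳ (inv-inverse k) ⟩
    1# * b                               ≈⟨ *-identityˡ b ⟩
    b                                    ∎

  -- (q^2;q^2)_N. Each factor is the 1 - x^2 in the denominator of the tridiagonal inverse of a
  -- transfer matrix.
  factor : ℕ → Carrier
  factor zero    = 1#
  factor (suc N) = factor N * (1# - q ^ suc N * q ^ suc N)

  -- Position i is the colour i - 1: positions 0 and n + 2 lie just outside of the range of colours.
  position : ℕ → ℕ → Carrier
  position N i = J (q ^ i) (q ^ (suc (suc n) ∸ i)) N N

  iterate-closed : ∀ N v → v ℕ.≤ n → iterate N v ≈ factor N * position N (suc v)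
  iterate-closed zero    v v≤n = sym (begin
    1# * (1# * 1# * Theta.ε R Q (q ^ suc v) (q ^ (suc n ∸ v)) 0 0) ≈⟨ solve 0 (con (+ 1) :* (con (+ 1) :* con (+ 1) :* con (+ 1)) := con (+ 1)) refl ⟩
    1# ∎)
  -- The index N + (N + 1) makes the cancelled factor 1 - q^(2N+2) = 1 - x^2.
  iterate-closed (suc N) v v≤n = cancelˡ (N ℕ.+ suc N) (begin
    (1# - q ^ (suc N ℕ.+ suc N)) * transfer x n (iterate N) v   ≈⟨ *-congʳ square ⟩
    (1# - x * x) * transfer x n (iterate N) v                   ≈⟨ transfer-solution x n v v≤n (iterate N) g interior left right ⟩
    (1# - x * x) * g (suc v)                                    ≈⟨ *-congʳ square ⟨
    (1# - q ^ (suc N ℕ.+ suc N)) * g (suc v)                    ∎)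
    where
    x = q ^ suc N
    g : ℕ → Carrier
    g i = factor (suc N) * position (suc N) i

    square : 1# - q ^ (suc N ℕ.+ suc N) ≈ 1# - x * x
    square = +-congˡ (-‿cong (^-homo-* q (suc N) (suc N)))

    interior : Interior x n (iterate N) g
    interior i i≤n = begin
      (1# - x * x) * iterate N i
        ≈⟨ *-congˡ (iterate-closed N i i≤n) ⟩
      (1# - x * x) * (factor N * position N (suc i))
        ≈⟨ *-congˡ (*-congˡ (J-cong refl suc-w N N)) ⟩
      (1# - x * x) * (factor N * J (q * q ^ i) (q * w) N N)
        ≈⟨ *-congˡ (*-congˡ (J-interior (q ^ i) w N)) ⟨
      (1# - x * x) * (factor N * ((1# + x * x) * J (q * q ^ i) (q * w) (suc N) (suc N)
        - (x * J (q ^ i) (q * (q * w)) (suc N) (suc N) + x * J (q * (q * q ^ i)) w (suc N) (suc N))))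
        ≈⟨ *-congˡ (*-congˡ (+-cong (*-congˡ (J-cong refl suc-w (suc N) (suc N)))
             (-‿cong (+-congʳ (*-congˡ (J-cong refl suc-suc-w (suc N) (suc N))))))) ⟨
      (1# - x * x) * (factor N * ((1# + x * x) * position (suc N) (suc i)
        - (x * position (suc N) i + x * position (suc N) (suc (suc i)))))
        ≈⟨ solve 5 (λ x f a b c → (con (+ 1) :- x :* x) :* (f :* ((con (+ 1) :+ x :* x) :* b :- (x :* a :+ x :* c)))
             := (con (+ 1) :+ x :* x) :* (f :* (con (+ 1) :- x :* x) :* b) :- (x :* (f :* (con (+ 1) :- x :* x) :* a) :+ x :* (f :* (con (+ 1) :- x :* x) :* c)))
             refl _ _ _ _ _ ⟩
      (1# + x * x) * g (suc i) - (x * g i + x * g (suc (suc i))) ∎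
      where
      w = q ^ (n ∸ i)
      suc-w : q ^ (suc n ∸ i) ≈ q * w
      suc-w = ^-congʳ q (ℕ.+-∸-assoc 1 i≤n)
      suc-suc-w : q ^ (suc (suc n) ∸ i) ≈ q * (q * w)
      suc-suc-w = ^-congʳ q (ℕ.+-∸-assoc 2 i≤n)

    left : g 0 ≈ x * g 1
    left = trans (*-congˡ (J-boundary torsion-free (q ^ suc n) refl N))
      (solve 3 (λ f x a → f :* (x :* a) := x :* (f :* a)) refl _ _ _)

    -- `J-mirror` replaces k by -k and so turns the reflection k ↦ -1-k at this end into k ↦ 1-k,
    -- already treated at the other end.
    right : g (suc (suc n)) ≈ x * g (suc n)
    right = begin
      factor (suc N) * J Q (q ^ (suc (suc n) ∸ suc (suc n))) (suc N) (suc N)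
        ≈⟨ *-congˡ (trans (J-cong refl (^-congʳ q (ℕ.n∸n≡0 n)) (suc N) (suc N)) (J-mirror Q 1# (suc N) (suc N))) ⟩
      factor (suc N) * J 1# Q (suc N) (suc N)
        ≈⟨ *-congˡ (J-boundary torsion-free (q ^ suc n) refl N) ⟩
      factor (suc N) * (x * J (q * 1#) (q ^ suc n) (suc N) (suc N))
        ≈⟨ *-congˡ (*-congˡ (trans (J-mirror (q * 1#) (q ^ suc n) (suc N) (suc N))
             (J-cong refl (^-congʳ q (≡.sym (ℕ.m+n∸n≡m 1 n))) (suc N) (suc N)))) ⟩
      factor (suc N) * (x * position (suc N) (suc n))
        ≈⟨ solve 3 (λ f x a → f :* (x :* a) := x :* (f :* a)) refl _ _ _ ⟩
      x * g (suc n) ∎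

-- From the closed form to infinite products

module IterateProduct {c ℓ} (R : CommutativeRing c ℓ)
  (torsion-free : TorsionFree R)
  (q : CommutativeRing.Carrier R) (inv : ℕ → CommutativeRing.Carrier R) (inv-inverse : PowerInverses R q inv)
  (n : ℕ) (invQ : ℕ → CommutativeRing.Carrier R)
  (invQ-inverse : PowerInverses R (SemiringExp._^_ (CommutativeRing.semiring R) q (suc (suc n))) invQ)
  where
  open CommutativeRing R
  open SemiringExp semiring
  open Pochhammer R
  open IntegerCoefficients R using (solve; _:=_; _:+_; _:*_; _:-_; :-_; con)
  open AntidiagonalSum R
  open TransferIterates R torsion-free q inv inv-inverse n
  open Theta R Q
  open SetoidReasoning setoid

  u-pochhammer : ∀ x inv (inv-inverse : PowerInverses R x inv) Q r →
                 BilateralSum.u R x inv inv-inverse Q r * pochhammer x x r ≈ 1#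
  u-pochhammer x inv inv-inverse Q zero    = *-identityˡ 1#
  u-pochhammer x inv inv-inverse Q (suc r) = begin
    inv r * u r * (pochhammer x x r * (1# - x ^ suc r))     ≈⟨ solve 4 (λ a b c d → a :* b :* (c :* d) := a :* d :* (b :* c)) refl _ _ _ _ ⟩
    inv r * (1# - x ^ suc r) * (u r * pochhammer x x r)     ≈⟨ *-cong (inv-inverse r) (u-pochhammer x inv inv-inverse Q r) ⟩
    1# * 1#                                                 ≈⟨ *-identityˡ 1# ⟩
    1#                                                      ∎
    where open BilateralSum R x inv inv-inverse Q using (u)

  inverse-unique : ∀ {a b c d} → a * b ≈ 1# → c * d ≈ 1# → b ≈ d → a ≈ c
  inverse-unique {a} {b} {c} {d} ab≈1 cd≈1 b≈d = begin
    a            ≈⟨ *-identityʳ a ⟨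
    a * 1#       ≈⟨ *-congˡ cd≈1 ⟨
    a * (c * d)  ≈⟨ solve 3 (λ a c d → a :* (c :* d) := a :* d :* c) refl _ _ _ ⟩
    a * d * c    ≈⟨ *-congʳ (*-congˡ b≈d) ⟨
    a * b * c    ≈⟨ *-congʳ ab≈1 ⟩
    1# * c       ≈⟨ *-identityˡ c ⟩
    c            ∎

  pochhammer-even-odd : ∀ N → pochhammer q q (N ℕ.+ N) ≈ pochhammer q (q ^ 2) N * factor N
  pochhammer-even-odd zero    = sym (*-identityˡ 1#)
  pochhammer-even-odd (suc N) = begin
    pochhammer q q (N ℕ.+ suc N) * (1# - q * q ^ (N ℕ.+ suc N))
      ≡⟨ ≡.cong (λ K → pochhammer q q K * (1# - q * q ^ K)) (ℕ.+-suc N N) ⟩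
    pochhammer q q (N ℕ.+ N) * (1# - q * q ^ (N ℕ.+ N)) * (1# - q * (q * q ^ (N ℕ.+ N)))
      ≈⟨ *-cong (*-cong (pochhammer-even-odd N) (+-congˡ (-‿cong (*-congˡ (sym squares)))))
                (+-congˡ (-‿cong (*-congˡ (*-congˡ (^-homo-* q N N))))) ⟩
    pochhammer q (q ^ 2) N * factor N * (1# - q * (q ^ 2) ^ N) * (1# - q * (q * (q ^ N * q ^ N)))
      ≈⟨ solve 5 (λ a b c x y → a :* b :* c :* (con (+ 1) :- x :* (x :* (y :* y))) := a :* c :* (b :* (con (+ 1) :- x :* y :* (x :* y)))) refl _ _ _ _ _ ⟩
    pochhammer q (q ^ 2) (suc N) * factor (suc N) ∎
    where
    squares : (q ^ 2) ^ N ≈ q ^ (N ℕ.+ N)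
    squares = trans (^-assocʳ q 2 N) (^-congʳ q (≡.cong (N ℕ.+_) (ℕ.+-identityʳ N)))

  -- Convergence in a ring without topology: sequences are constant, or zero, beyond index m. `D`
  -- and `E` stand for (q;q)_∞ and (Q;Q)_∞.
  module _ (m v : ℕ) (v≤n : v ℕ.≤ n)
    (D E : Carrier)
    (pochhammer-q : ∀ r → m ℕ.< r → pochhammer q q r ≈ D)
    (pochhammer-Q : ∀ r → m ℕ.< r → pochhammer Q Q r ≈ E)
    (θz≈0 : ∀ k → m ℕ.< k → θ (q ^ suc v) k ≈ 0#)
    (θw≈0 : ∀ k → m ℕ.< k → θ (q ^ (suc n ∸ v)) k ≈ 0#)
    where

    N : ℕ
    N = suc (m ℕ.+ m)

    z w Σε : Carrier
    z = q ^ suc v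
    w = q ^ (suc n ∸ v)
    Σε = anti (N ℕ.+ N) (λ r s → ε z w r N)

    -- The right side does not depend on the base x. This links base q, in which the iterates are
    -- expressed, to base Q, in which the sum is known as a product.
    J-limit : ∀ x inv (inv-inverse : PowerInverses R x inv) P →
              (∀ r → m ℕ.< r → pochhammer x x r ≈ P) →
              BilateralSum.J R x inv inv-inverse Q z w N N * (P * P) ≈ Σε
    J-limit x inv inv-inverse P pochhammer-x = begin
      J z w N N * (P * P)           ≈⟨ *-congʳ (J-stable (u (suc m)) stable z w θz≈0 θw≈0) ⟩
      U * U * Σε * (P * P)          ≈⟨ solve 3 (λ u p s → u :* u :* s :* (p :* p) := u :* p :* (u :* p) :* s) refl _ _ _ ⟩
      (U * P) * (U * P) * Σε        ≈⟨ *-congʳ (*-cong UP≈1 UP≈1) ⟩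
      1# * 1# * Σε                  ≈⟨ trans (*-congʳ (*-identityˡ 1#)) (*-identityˡ Σε) ⟩
      Σε                            ∎
      where
      open BilateralSum R x inv inv-inverse Q using (u; J)
      open StableRange R x inv inv-inverse Q m using (J-stable)
      U = u (suc m)
      UP≈1 : U * P ≈ 1#
      UP≈1 = trans (*-congˡ (sym (pochhammer-x (suc m) ℕ.≤-refl))) (u-pochhammer x inv inv-inverse Q (suc m))
      stable : ∀ r → m ℕ.< r → u r ≈ U
      stable r m<r = inverse-unique (u-pochhammer x inv inv-inverse Q r) UP≈1 (pochhammer-x r m<r)

    m<N : m ℕ.< N
    m<N = ℕ.s≤s (ℕ.m≤m+n m m)

    m<N+N : m ℕ.< N ℕ.+ N
    m<N+N = ℕ.≤-trans m<N (ℕ.m≤m+n N N)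

    iterate-product : iterate N v * (pochhammer q (q ^ 2) N * D) ≈ pochhammer z Q N * pochhammer w Q N * E
    iterate-product = begin
      iterate N v * (pochhammer q (q ^ 2) N * D)
        ≈⟨ *-congʳ (iterate-closed N v v≤n) ⟩
      factor N * position N (suc v) * (pochhammer q (q ^ 2) N * D)
        ≈⟨ solve 4 (λ f j p d → f :* j :* (p :* d) := j :* (p :* f :* d)) refl _ _ _ _ ⟩
      position N (suc v) * (pochhammer q (q ^ 2) N * factor N * D)
        ≈⟨ *-congˡ (*-congʳ (trans (sym (pochhammer-even-odd N)) (pochhammer-q (N ℕ.+ N) m<N+N))) ⟩
      position N (suc v) * (D * D)
        ≈⟨ J-limit q inv inv-inverse D pochhammer-q ⟩
      Σε
        ≈⟨ J-limit Q invQ invQ-inverse E pochhammer-Q ⟨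
      BilateralSum.J R Q invQ invQ-inverse Q z w N N * (E * E)
        ≈⟨ solve 2 (λ j e → j :* (e :* e) := e :* j :* e) refl _ _ ⟩
      E * BilateralSum.J R Q invQ invQ-inverse Q z w N N * E
        ≈⟨ *-congʳ (*-congʳ (pochhammer-Q (N ℕ.+ N) m<N+N)) ⟨
      pochhammer Q Q (N ℕ.+ N) * BilateralSum.J R Q invQ invQ-inverse Q z w N N * E
        ≈⟨ *-congʳ (FiniteTripleProduct.J-product R Q invQ invQ-inverse zw≈Q N N) ⟩
      pochhammer z Q N * pochhammer w Q N * E ∎
      where
      zw≈Q : z * w ≈ Q
      zw≈Q = trans (sym (^-homo-* q (suc v) (suc n ∸ v))) (^-congʳ q (≡.cong suc (ℕ.m+[n∸m]≡n (ℕ.≤-trans v≤n (ℕ.n≤1+n n)))))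

-- Gaps larger than the colour distance

module GapIterates {c ℓ} (R : CommutativeRing c ℓ)
  (q : CommutativeRing.Carrier R) (n : ℕ) (D : ℕ)
  where
  open CommutativeRing R
  open SemiringExp semiring
  open SemiringSum semiring using (sum; sum-cong-≋; *-distribˡ-sum)
  open IntegerCoefficients R using (solve; _:=_; _:+_; _:*_; _:-_; :-_; con)
  open Transfer R
  open Pochhammer R
  open SetoidReasoning setoid

  -- `D` bounds the excess of a gap over the colour distance. `D = 0` describes `𝒞`; `D = m`
  -- describes `𝒞≥` up to weight m, as the excess of a gap is at most the weight.
  gapTransfer : Carrier → (ℕ → Carrier) → ℕ → Carrier
  gapTransfer x f v = sum {suc n} λ i → sum {suc D} λ d → f (toℕ i) * x ^ (∣ toℕ i - v ∣ ℕ.+ toℕ d)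

  gapSum : Carrier → Carrier
  gapSum x = sum {suc D} λ d → x ^ toℕ d

  gapTransfer-factor : ∀ x f v → gapTransfer x f v ≈ gapSum x * transfer x n f v
  gapTransfer-factor x f v = trans (sum-cong-≋ {suc n} inner)
    (sym (*-distribˡ-sum {suc n} (gapSum x) (λ i → f (toℕ i) * x ^ ∣ toℕ i - v ∣)))
    where
    inner : ∀ i → sum {suc D} (λ d → f (toℕ i) * x ^ (∣ toℕ i - v ∣ ℕ.+ toℕ d)) ≈ gapSum x * (f (toℕ i) * x ^ ∣ toℕ i - v ∣)
    inner i = begin
      sum {suc D} (λ d → f (toℕ i) * x ^ (∣ toℕ i - v ∣ ℕ.+ toℕ d))
        ≈⟨ sum-cong-≋ {suc D} (λ d → trans (*-congˡ (^-homo-* x ∣ toℕ i - v ∣ (toℕ d))) (sym (*-assoc (f (toℕ i)) (x ^ ∣ toℕ i - v ∣) (x ^ toℕ d)))) ⟩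
      sum {suc D} (λ d → f (toℕ i) * x ^ ∣ toℕ i - v ∣ * x ^ toℕ d)
        ≈⟨ *-distribˡ-sum {suc D} (f (toℕ i) * x ^ ∣ toℕ i - v ∣) (λ d → x ^ toℕ d) ⟨
      f (toℕ i) * x ^ ∣ toℕ i - v ∣ * gapSum x
        ≈⟨ *-comm _ _ ⟩
      gapSum x * (f (toℕ i) * x ^ ∣ toℕ i - v ∣) ∎

  gapIterate : ℕ → ℕ → Carrier
  gapIterate zero    v = 1#
  gapIterate (suc N) v = gapTransfer (q ^ suc N) (gapIterate N) v

  gapProduct : ℕ → Carrier
  gapProduct zero    = 1#
  gapProduct (suc N) = gapSum (q ^ suc N) * gapProduct N

  transfer-scale : ∀ x a {f g} → (∀ i → f i ≈ a * g i) → ∀ v → transfer x n f v ≈ a * transfer x n g v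
  transfer-scale x a {f} {g} f≈ag v = trans
    (sum-cong-≋ {suc n} λ i → trans (*-congʳ (f≈ag (toℕ i))) (*-assoc a (g (toℕ i)) (x ^ ∣ toℕ i - v ∣)))
    (sym (*-distribˡ-sum {suc n} a (λ i → g (toℕ i) * x ^ ∣ toℕ i - v ∣)))

  gapSum-telescope : ∀ x → (1# - x) * gapSum x ≈ 1# - x ^ suc D
  gapSum-telescope x = go D
    where
    go : ∀ K → (1# - x) * sum {suc K} (λ d → x ^ toℕ d) ≈ 1# - x ^ suc K
    go zero    = solve 1 (λ x → (con (+ 1) :- x) :* (con (+ 1) :+ con (+ 0)) := con (+ 1) :- x :* con (+ 1)) refl x
    go (suc K) = begin
      (1# - x) * (1# + sum {suc K} (λ d → x * x ^ toℕ d))    ≈⟨ *-congˡ (+-congˡ (*-distribˡ-sum {suc K} x (λ d → x ^ toℕ d))) ⟨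
      (1# - x) * (1# + x * sum {suc K} (λ d → x ^ toℕ d))
        ≈⟨ solve 2 (λ x s → (con (+ 1) :- x) :* (con (+ 1) :+ x :* s) := con (+ 1) :- x :+ x :* ((con (+ 1) :- x) :* s)) refl _ _ ⟩
      1# - x + x * ((1# - x) * sum {suc K} (λ d → x ^ toℕ d)) ≈⟨ +-congˡ (*-congˡ (go K)) ⟩
      1# - x + x * (1# - x ^ suc K)
        ≈⟨ solve 2 (λ x y → con (+ 1) :- x :+ x :* (con (+ 1) :- y) := con (+ 1) :- x :* y) refl _ _ ⟩
      1# - x * x ^ suc K ∎

  module _ (torsion-free : TorsionFree R) (inv : ℕ → Carrier) (inv-inverse : PowerInverses R q inv) where
    open TransferIterates R torsion-free q inv inv-inverse n using (iterate)

    gapIterate-factor : ∀ N v → gapIterate N v ≈ gapProduct N * iterate N v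
    gapIterate-factor zero    v = sym (*-identityˡ 1#)
    gapIterate-factor (suc N) v = begin
      gapTransfer x (gapIterate N) v                               ≈⟨ gapTransfer-factor x (gapIterate N) v ⟩
      gapSum x * transfer x n (gapIterate N) v                     ≈⟨ *-congˡ (transfer-scale x (gapProduct N) (gapIterate-factor N) v) ⟩
      gapSum x * (gapProduct N * transfer x n (iterate N) v)       ≈⟨ *-assoc _ _ _ ⟨
      gapProduct (suc N) * iterate (suc N) v                       ∎
      where x = q ^ suc N

  -- Nilpotency makes the finite sum 1 + x + ... + x^D an exact inverse of 1 - x.
  gapProduct-pochhammer : (∀ k → (q ^ suc k) ^ suc D ≈ 0#) → ∀ N → gapProduct N * pochhammer q q N ≈ 1#
  gapProduct-pochhammer nilpotent zero    = *-identityˡ 1#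
  gapProduct-pochhammer nilpotent (suc N) = begin
    gapSum x * gapProduct N * (pochhammer q q N * (1# - x))   ≈⟨ solve 4 (λ a b c d → a :* b :* (c :* d) := d :* a :* (b :* c)) refl _ _ _ _ ⟩
    (1# - x) * gapSum x * (gapProduct N * pochhammer q q N)   ≈⟨ *-cong (gapSum-telescope x) (gapProduct-pochhammer nilpotent N) ⟩
    (1# - x ^ suc D) * 1#                                     ≈⟨ *-congʳ (+-congˡ (-‿cong (nilpotent N))) ⟩
    (1# - 0#) * 1#                                            ≈⟨ solve 0 ((con (+ 1) :- con (+ 0)) :* con (+ 1) := con (+ 1)) refl ⟩
    1#                                                        ∎
    where x = q ^ suc N

module SingleGap {c ℓ} (R : CommutativeRing c ℓ) (q : CommutativeRing.Carrier R) (n : ℕ) where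
  open CommutativeRing R
  open GapIterates R q n 0

  gapProduct-zero : ∀ N → gapProduct N ≈ 1#
  gapProduct-zero zero    = refl
  gapProduct-zero (suc N) = trans (*-cong (+-identityʳ 1#) (gapProduct-zero N)) (*-identityˡ 1#)

-- Power series

private module ΣZ = SemiringSum ℤ.+-*-semiring

infixl 6 _+ₛ_
infix  4 _≈[_]_

0ₛ : Series
0ₛ _ = 0ℤ

_+ₛ_ : Series → Series → Series
(f +ₛ g) j = f j ℤ.+ g j

negₛ : Series → Series
negₛ f j = ℤ.- f j

*ₛ-cong≤ : ∀ {f f′ g g′} m → (∀ j → j ℕ.≤ m → f j ≡ f′ j) → (∀ j → j ℕ.≤ m → g j ≡ g′ j) → (f *ₛ g) m ≡ (f′ *ₛ g′) m
*ₛ-cong≤ m f≡f′ g≡g′ = ΣZ.sum-cong-≗ {suc m} λ k →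
  ≡.cong₂ ℤ._*_ (f≡f′ _ (toℕ≤pred[n] k)) (g≡g′ _ (ℕ.m∸n≤m m (toℕ k)))

*ₛ-distribʳ : ∀ h f g → (f +ₛ g) *ₛ h ≗ f *ₛ h +ₛ g *ₛ h
*ₛ-distribʳ h f g m = ≡.trans
  (ΣZ.sum-cong-≗ {suc m} λ k → ℤ.*-distribʳ-+ (h (m ∸ toℕ k)) (f (toℕ k)) (g (toℕ k)))
  (ΣZ.∑-distrib-+ {suc m} (λ k → f (toℕ k) ℤ.* h (m ∸ toℕ k)) (λ k → g (toℕ k) ℤ.* h (m ∸ toℕ k)))

*ₛ-scaleˡ : ∀ c f g m → ((λ k → c ℤ.* f k) *ₛ g) m ≡ c ℤ.* (f *ₛ g) m
*ₛ-scaleˡ c f g m = ≡.trans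
  (ΣZ.sum-cong-≗ {suc m} λ k → ℤ.*-assoc c (f (toℕ k)) (g (m ∸ toℕ k)))
  (≡.sym (ΣZ.*-distribˡ-sum {suc m} c (λ k → f (toℕ k) ℤ.* g (m ∸ toℕ k))))

-- (f * g)_{m+1} = f_0 g_{m+1} + (f' * g)_m for the shift f' of f holds by computation;
-- commutativity and associativity follow from it by induction on the coefficient.
*ₛ-comm : ∀ f g → f *ₛ g ≗ g *ₛ f
*ₛ-comm f g zero          = ≡.cong (ℤ._+ 0ℤ) (ℤ.*-comm (f 0) (g 0))
*ₛ-comm f g (suc zero)    = lemma (f 0) (f 1) (g 0) (g 1)
  where
  lemma : ∀ a b c d → a ℤ.* d ℤ.+ (b ℤ.* c ℤ.+ 0ℤ) ≡ c ℤ.* b ℤ.+ (d ℤ.* a ℤ.+ 0ℤ)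
  lemma = solveℤ-∀
*ₛ-comm f g (suc (suc m)) = begin
  f 0 ℤ.* g (suc (suc m)) ℤ.+ (f ∘ suc *ₛ g) (suc m)
    ≡⟨ ≡.cong (ℤ._+_ (f 0 ℤ.* g (suc (suc m)))) (*ₛ-comm (f ∘ suc) g (suc m)) ⟩
  f 0 ℤ.* g (suc (suc m)) ℤ.+ (g 0 ℤ.* f (suc (suc m)) ℤ.+ (g ∘ suc *ₛ f ∘ suc) m)
    ≡⟨ ≡.cong (λ y → f 0 ℤ.* g (suc (suc m)) ℤ.+ (g 0 ℤ.* f (suc (suc m)) ℤ.+ y)) (*ₛ-comm (g ∘ suc) (f ∘ suc) m) ⟩
  f 0 ℤ.* g (suc (suc m)) ℤ.+ (g 0 ℤ.* f (suc (suc m)) ℤ.+ (f ∘ suc *ₛ g ∘ suc) m)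
    ≡⟨ swap (f 0 ℤ.* g (suc (suc m))) (g 0 ℤ.* f (suc (suc m))) _ ⟩
  g 0 ℤ.* f (suc (suc m)) ℤ.+ (f *ₛ g ∘ suc) (suc m)
    ≡⟨ ≡.cong (ℤ._+_ (g 0 ℤ.* f (suc (suc m)))) (*ₛ-comm f (g ∘ suc) (suc m)) ⟩
  g 0 ℤ.* f (suc (suc m)) ℤ.+ (g ∘ suc *ₛ f) (suc m) ∎
  where
  open ≡.≡-Reasoning
  swap : ∀ a b c → a ℤ.+ (b ℤ.+ c) ≡ b ℤ.+ (a ℤ.+ c)
  swap = solveℤ-∀

*ₛ-assoc : ∀ f g h → (f *ₛ g) *ₛ h ≗ f *ₛ (g *ₛ h)
*ₛ-assoc f g h zero    = lemma (f 0) (g 0) (h 0)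
  where
  lemma : ∀ a b c → (a ℤ.* b ℤ.+ 0ℤ) ℤ.* c ℤ.+ 0ℤ ≡ a ℤ.* (b ℤ.* c ℤ.+ 0ℤ) ℤ.+ 0ℤ
  lemma = solveℤ-∀
*ₛ-assoc f g h (suc m) = begin
  (f 0 ℤ.* g 0 ℤ.+ 0ℤ) ℤ.* h (suc m) ℤ.+ (((λ k → f 0 ℤ.* g (suc k)) +ₛ (f ∘ suc *ₛ g)) *ₛ h) m
    ≡⟨ ≡.cong (ℤ._+_ ((f 0 ℤ.* g 0 ℤ.+ 0ℤ) ℤ.* h (suc m))) (≡.trans
         (*ₛ-distribʳ h (λ k → f 0 ℤ.* g (suc k)) (f ∘ suc *ₛ g) m)
         (≡.cong₂ ℤ._+_ (*ₛ-scaleˡ (f 0) (g ∘ suc) h m) (*ₛ-assoc (f ∘ suc) g h m))) ⟩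
  (f 0 ℤ.* g 0 ℤ.+ 0ℤ) ℤ.* h (suc m) ℤ.+ (f 0 ℤ.* (g ∘ suc *ₛ h) m ℤ.+ (f ∘ suc *ₛ (g *ₛ h)) m)
    ≡⟨ lemma (f 0) (g 0) (h (suc m)) _ _ ⟩
  f 0 ℤ.* (g 0 ℤ.* h (suc m) ℤ.+ (g ∘ suc *ₛ h) m) ℤ.+ (f ∘ suc *ₛ (g *ₛ h)) m ∎
  where
  open ≡.≡-Reasoning
  lemma : ∀ a b c d e → (a ℤ.* b ℤ.+ 0ℤ) ℤ.* c ℤ.+ (a ℤ.* d ℤ.+ e) ≡ a ℤ.* (b ℤ.* c ℤ.+ d) ℤ.+ e
  lemma = solveℤ-∀

-- Series modulo q^(m+1)

record _≈[_]_ (f : Series) (m : ℕ) (g : Series) : Set where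
  constructor congruent
  field coefficient : ∀ j → j ℕ.≤ m → f j ≡ g j

open _≈[_]_

≗⇒≈ : ∀ {m f g} → f ≗ g → f ≈[ m ] g
≗⇒≈ f≗g = congruent λ j _ → f≗g j

isCommutativeRing : ∀ m → IsCommutativeRing (_≈[ m ]_) _+ₛ_ _*ₛ_ negₛ 0ₛ 1ₛ
isCommutativeRing m = record
  { isRing = record
    { +-isAbelianGroup = record
      { isGroup = record
        { isMonoid = record
          { isSemigroup = record
            { isMagma = record
              { isEquivalence = record
                { refl  = ≗⇒≈ λ _ → ≡.refl
                ; sym   = λ f≈g → congruent λ j j≤m → ≡.sym (coefficient f≈g j j≤m)
                ; trans = λ f≈g g≈h → congruent λ j j≤m → ≡.trans (coefficient f≈g j j≤m) (coefficient g≈h j j≤m)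
                }
              ; ∙-cong = λ f≈g h≈k → congruent λ j j≤m → ≡.cong₂ ℤ._+_ (coefficient f≈g j j≤m) (coefficient h≈k j j≤m)
              }
            ; assoc = λ f g h → ≗⇒≈ λ j → ℤ.+-assoc (f j) (g j) (h j)
            }
          ; identity = (λ f → ≗⇒≈ λ j → ℤ.+-identityˡ (f j)) , (λ f → ≗⇒≈ λ j → ℤ.+-identityʳ (f j))
          }
        ; inverse = (λ f → ≗⇒≈ λ j → ℤ.+-inverseˡ (f j)) , (λ f → ≗⇒≈ λ j → ℤ.+-inverseʳ (f j))
        ; ⁻¹-cong = λ f≈g → congruent λ j j≤m → ≡.cong ℤ.-_ (coefficient f≈g j j≤m)
        }
      ; comm = λ f g → ≗⇒≈ λ j → ℤ.+-comm (f j) (g j)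
      }
    ; *-cong = λ f≈g h≈k → congruent λ j j≤m → *ₛ-cong≤ j
        (λ l l≤j → coefficient f≈g l (ℕ.≤-trans l≤j j≤m))
        (λ l l≤j → coefficient h≈k l (ℕ.≤-trans l≤j j≤m))
    ; *-assoc = λ f g h → ≗⇒≈ (*ₛ-assoc f g h)
    ; *-identity = (λ f → ≗⇒≈ (*ₛ-identityˡ f)) , (λ f → ≗⇒≈ (*ₛ-identityʳ f))
    ; distrib = (λ h f g → ≗⇒≈ λ j → ≡.trans (*ₛ-comm h (f +ₛ g) j) (≡.trans (*ₛ-distribʳ h f g j)
                   (≡.cong₂ ℤ._+_ (*ₛ-comm f h j) (*ₛ-comm g h j))))
              , (λ h f g → ≗⇒≈ (*ₛ-distribʳ h f g))
    }
  ; *-comm = λ f g → ≗⇒≈ (*ₛ-comm f g)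
  }

truncatedRing : ℕ → CommutativeRing 0ℓ 0ℓ
truncatedRing m = record { isCommutativeRing = isCommutativeRing m }

truncated-torsion-free : ∀ m f → (f +ₛ f) ≈[ m ] 0ₛ → f ≈[ m ] 0ₛ
truncated-torsion-free m f 2f≈0 = congruent λ j j≤m → halve (f j) (coefficient 2f≈0 j j≤m)
  where
  halve : ∀ (i : ℤ) → i ℤ.+ i ≡ 0ℤ → i ≡ 0ℤ
  halve (+ zero) _ = ≡.refl

Order≥⇒≈0 : ∀ {m k f} → m ℕ.< k → Order≥ k f → f ≈[ m ] 0ₛ
Order≥⇒≈0 m<k f≥k = congruent λ j j≤m → f≥k j (ℕ.≤-<-trans j≤m m<k)

Order≥-neg : ∀ {k f} → Order≥ k f → Order≥ k (negₛ f)
Order≥-neg f≥k j j<k = ≡.cong ℤ.-_ (f≥k j j<k)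

Order≥1 : ∀ {f} → f 0 ≡ 0ℤ → Order≥ 1 f
Order≥1 f₀≡0 zero    _          = f₀≡0
Order≥1 f₀≡0 (suc _) (ℕ.s≤s ())

^ₛ-suc-constant : ∀ f → f 0 ≡ 0ℤ → ∀ k → (f ^ₛ suc k) 0 ≡ 0ℤ
^ₛ-suc-constant f f₀≡0 k = ≡.trans (*ₛ-constant f (f ^ₛ k)) (≡.cong (ℤ._* (f ^ₛ k) 0) f₀≡0)

module Truncated (m : ℕ) where
  open CommutativeRing (truncatedRing m) public
  open SemiringExp semiring public using (_^_)
  open Pochhammer (truncatedRing m) public

  ^≡^ₛ : ∀ f k → f ^ k ≡ f ^ₛ k
  ^≡^ₛ f zero    = ≡.refl
  ^≡^ₛ f (suc k) = ≡.cong (f *ₛ_) (^≡^ₛ f k)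

  pochhammer≡poch : ∀ a x N → pochhammer a x N ≡ poch a x N
  pochhammer≡poch a x zero    = ≡.refl
  pochhammer≡poch a x (suc N) = ≡.cong₂ (λ p y → p *ₛ (1ₛ -ₛ a *ₛ y)) (pochhammer≡poch a x N) (^≡^ₛ x N)

  pochhammer≈poch∞ : ∀ a x → x 0 ≡ 0ℤ → ∀ N → m ℕ.< N → pochhammer a x N ≈[ m ] poch∞ a x
  pochhammer≈poch∞ a x x₀≡0 N m<N = trans (reflexive (pochhammer≡poch a x N))
    (congruent λ j j≤m → poch-limit a x₀≡0 j N (ℕ.≤-<-trans j≤m m<N))

  powerInverse : Series → ℕ → Series
  powerInverse x k = (1ₛ -ₛ x ^ₛ suc k) ⁻¹ₛ

  powerInverse-inverse : ∀ x → x 0 ≡ 0ℤ → ∀ k → powerInverse x k *ₛ (1ₛ +ₛ negₛ (x ^ suc k)) ≈[ m ] 1ₛ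
  powerInverse-inverse x x₀≡0 k = trans (*-comm (powerInverse x k) (1ₛ +ₛ negₛ (x ^ suc k))) (trans
    (reflexive (≡.cong (λ y → (1ₛ -ₛ y) *ₛ powerInverse x k) (^≡^ₛ x (suc k))))
    (≗⇒≈ (*ₛ-inverseʳ (1ₛ -ₛ x ^ₛ suc k) (≡.cong (ℤ._-_ 1ℤ) (^ₛ-suc-constant x x₀≡0 k)))))

  -- Every factor of `θ` contains z, which has no constant term; this confines the theta series
  -- modulo q^(m+1) to |k| ≤ m.
  θ-order : ∀ Q z → z 0 ≡ 0ℤ → ∀ k → Order≥ k (Theta.θ (truncatedRing m) Q z k)
  θ-order Q z z₀≡0 zero    _ ()
  θ-order Q z z₀≡0 (suc k) = *ₛ-order {1} {k} {f = negₛ (z *ₛ Q ^ k)} {g = Theta.θ (truncatedRing m) Q z k}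
    (Order≥-neg (*ₛ-order {1} {0} {f = z} {g = Q ^ k} (Order≥1 z₀≡0) (λ _ ()))) (θ-order Q z z₀≡0 k)

  *-/ₛ : ∀ {f g h} → g 0 ≡ 1ℤ → f *ₛ g ≈[ m ] h → f ≈[ m ] (h /ₛ g)
  *-/ₛ {f} {g} {h} g₀≡1 fg≈h = begin
    f                     ≈⟨ *-identityʳ f ⟨
    f *ₛ 1ₛ               ≈⟨ *-congˡ {x = f} (≗⇒≈ (*ₛ-inverseʳ g g₀≡1)) ⟨
    f *ₛ (g *ₛ g ⁻¹ₛ)     ≈⟨ *-assoc f g (g ⁻¹ₛ) ⟨
    f *ₛ g *ₛ g ⁻¹ₛ       ≈⟨ *-congʳ {x = g ⁻¹ₛ} fg≈h ⟩
    h /ₛ g                ∎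
    where open import Relation.Binary.Reasoning.Setoid setoid

-- Enumeration of coloured partitions

open import Data.Product using (_×_)
open import Relation.Binary.PropositionalEquality using (refl; sym; trans; cong; cong₂; subst)

module _ {A : Set} where

  last-∷⁺ : ∀ (p : A) π → last (p ∷⁺ π) ≡ last π
  last-∷⁺ p (r ∷ xs) with initLast xs
  ... | []            = refl
  ... | ys List.∷ʳ′ y = refl

  penultimate-∷⁺ : ∀ (p r s : A) xs → penultimate (p ∷ r ∷ s ∷ xs) ≡ penultimate (r ∷ s ∷ xs)
  penultimate-∷⁺ p r s xs with initLast xs
  ... | []            = refl
  ... | ys List.∷ʳ′ y = refl

  ∷⁺-injective : ∀ {p r : A} {π ρ} → p ∷⁺ π ≡ r ∷⁺ ρ → p ≡ r × π ≡ ρ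
  ∷⁺-injective refl = refl , refl

_≟ₚ_ : ∀ {n} (p r : ColouredPart n) → Dec (p ≡ r)
part k u ≟ₚ part l v = map′ (λ (k≡l , u≡v) → cong₂ part k≡l u≡v) (λ p≡r → cong value p≡r , cong colour p≡r)
  (k ℕ.≟ l ×-dec u ≟ᶠ v)

module Enumeration (n : ℕ) (i : Fin (suc n)) where

  Part : Set
  Part = ColouredPart n

  ground : Part
  ground = part 0 i

  -- Sequences grow from the last part towards the first; `d` is the excess of the new gap over the
  -- colour distance.
  above : List⁺ Part → Fin (suc n) → ℕ → Part
  above π u d = part (value (head π) ℕ.+ (∣ toℕ u - toℕ (colour (head π)) ∣ ℕ.+ d)) u

  IsPadding : Part → List⁺ Part → Set
  IsPadding p π = p ≡ ground × π ≡ ground ∷ []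

  isPadding? : ∀ p π → Dec (IsPadding p π)
  isPadding? p (r ∷ [])     = p ≟ₚ ground ×-dec map′ (cong (_∷ [])) (cong head) (r ≟ₚ ground)
  isPadding? p (r ∷ s ∷ xs) = no λ ()

  -- Not repeating the ground part lets sequences of different lengths arise from
  -- the same number of extensions.
  extend : List⁺ Part → Part → List⁺ Part
  extend π p with isPadding? p π
  ... | yes _ = π
  ... | no  _ = p ∷⁺ π

  extend-head : ∀ π p → head (extend π p) ≡ p
  extend-head π p with isPadding? p π
  ... | yes (refl , refl) = refl
  ... | no  _             = refl

  -- Padding is invisible to the weight because `ground` has value 0.
  extend-weight : ∀ π p → weight (extend π p) ≡ value p ℕ.+ weight π
  extend-weight π p with isPadding? p π
  ... | yes (refl , refl) = refl
  ... | no  _             = refl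

  -- A padding step returns one part and any other step at least two, so the mixed cases are
  -- impossible. Hence no sequence is enumerated twice.
  extend-injective : ∀ π ρ {p r} → extend π p ≡ extend ρ r → π ≡ ρ × p ≡ r
  extend-injective π ρ {p} {r} eq with isPadding? p π | isPadding? r ρ
  extend-injective π ρ eq | yes (p≡ , π≡) | yes (r≡ , ρ≡) = trans π≡ (sym ρ≡) , trans p≡ (sym r≡)
  extend-injective π ρ () | yes (refl , refl) | no _
  extend-injective π ρ () | no _ | yes (refl , refl)
  extend-injective π ρ eq | no _ | no _ = let p≡r , π≡ρ = ∷⁺-injective eq in π≡ρ , p≡r

  above-injective : ∀ π {u v d e} → above π u d ≡ above π v e → u ≡ v × d ≡ e
  above-injective π {u} eq with refl ← cong colour eq =
    refl , ℕ.+-cancelˡ-≡ ∣ toℕ u - toℕ (colour (head π)) ∣ _ _ (ℕ.+-cancelˡ-≡ (value (head π)) _ _ (cong value eq))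

  module _ (D : ℕ) where

    steps : List (Fin (suc n) × Fin (suc D))
    steps = cartesianProduct (allFin (suc n)) (allFin (suc D))

    extendBy : List⁺ Part → Fin (suc n) × Fin (suc D) → List⁺ Part
    extendBy π (u , d) = extend π (above π u (toℕ d))

    enumerate : ℕ → List (List⁺ Part)
    enumerate zero    = (ground ∷ []) ∷ []
    enumerate (suc N) = cartesianProductWith extendBy (enumerate N) steps

    extendBy-injective : ∀ {π ρ s t} → extendBy π s ≡ extendBy ρ t → π ≡ ρ × s ≡ t
    extendBy-injective {π} {ρ} eq with refl , above≡ ← extend-injective π ρ eq =
      let u≡v , d≡e = above-injective π above≡ in refl , cong₂ _,_ u≡v (toℕ-injective d≡e)

    enumerate-unique : ∀ N → Unique (enumerate N)
    enumerate-unique zero    = [] ∷ []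
    enumerate-unique (suc N) = Unique.cartesianProductWith⁺ extendBy extendBy-injective
      (enumerate-unique N) (Unique.cartesianProduct⁺ (Unique.allFin⁺ (suc n)) (Unique.allFin⁺ (suc D)))

  -- Sequences built without padding, the excesses being restricted by `A`: only 0 for `𝒞`,
  -- arbitrary for `𝒞≥`.
  data Admissible (A : ℕ → Set) : List⁺ Part → Set where
    single : Admissible A (ground ∷ [])
    step   : ∀ {π} u d → A d → Admissible A π → ¬ IsPadding (above π u d) π → Admissible A (above π u d ∷⁺ π)

  module _ {A : ℕ → Set} where

    extend-padding : ∀ {π p} → IsPadding p π → extend π p ≡ π
    extend-padding {π} {p} padding with isPadding? p π
    ... | yes _ = refl
    ... | no  ¬padding = contradiction padding ¬padding

    extend-¬padding : ∀ {π p} → ¬ IsPadding p π → extend π p ≡ p ∷⁺ π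
    extend-¬padding {π} {p} ¬padding with isPadding? p π
    ... | yes padding = contradiction padding ¬padding
    ... | no  _       = refl

    extend-admissible : ∀ π u d → A d → Admissible A π → Admissible A (extend π (above π u d))
    extend-admissible π u d Ad admissible with isPadding? (above π u d) π
    ... | yes _        = admissible
    ... | no  ¬padding = step u d Ad admissible ¬padding

    enumerate-sound : ∀ {D} → (∀ d → d ℕ.≤ D → A d) → ∀ N {π} → π ∈ enumerate D N → Admissible A π
    enumerate-sound     ≤D⇒A zero    (here refl) = single
    enumerate-sound {D} ≤D⇒A (suc N) π∈
      with ρ , (u , d) , ρ∈ , _ , refl ← ∈-cartesianProductWith⁻ (extendBy D) (enumerate D N) (steps D) π∈ =
      extend-admissible ρ u (toℕ d) (≤D⇒A (toℕ d) (toℕ≤pred[n] d)) (enumerate-sound ≤D⇒A N ρ∈)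

    extend-enumerated : ∀ D N {π} u d → d ℕ.≤ D → π ∈ enumerate D N → extend π (above π u d) ∈ enumerate D (suc N)
    extend-enumerated D N {π} u d d≤D π∈ = subst (λ e → extend π (above π u e) ∈ enumerate D (suc N)) (toℕ-fromℕ< (s≤s d≤D))
      (∈-cartesianProductWith⁺ (extendBy D) π∈ (∈-cartesianProduct⁺ (∈-allFin u) (∈-allFin (fromℕ< (s≤s d≤D)))))

    single-enumerated : ∀ D N → (ground ∷ []) ∈ enumerate D N
    single-enumerated D zero    = here refl
    single-enumerated D (suc N) = subst (_∈ enumerate D (suc N))
      (extend-padding (cong₂ part (trans (ℕ.+-identityʳ _) (ℕ.∣n-n∣≡0 (toℕ i))) refl , refl))
      (extend-enumerated D N i 0 z≤n (single-enumerated D N))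

    enumerate-complete : ∀ {m D} → (∀ d → A d → d ℕ.≤ m → d ℕ.≤ D) → ∀ N {π} → Admissible A π →
                         weight π ℕ.≤ m → List⁺.length π ℕ.≤ suc N → π ∈ enumerate D N
    enumerate-complete A⇒≤D N single _ _ = single-enumerated _ N
    enumerate-complete A⇒≤D zero (step {r ∷ xs} u d Ad admissible ¬padding) _ (s≤s ())
    enumerate-complete {m} {D} A⇒≤D (suc N) (step {π} u d Ad admissible ¬padding) weight≤m (s≤s length≤) =
      subst (_∈ enumerate D (suc N)) (extend-¬padding ¬padding)
        (extend-enumerated D N u d (A⇒≤D d Ad d≤m) (enumerate-complete A⇒≤D N admissible
          (ℕ.≤-trans (ℕ.m≤n+m (weight π) (value (above π u d))) weight≤m) length≤))
      where
      d≤m : d ℕ.≤ m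
      d≤m = ℕ.≤-trans (ℕ.≤-trans (ℕ.m≤n+m d ∣ toℕ u - toℕ (colour (head π)) ∣) (ℕ.m≤n+m _ (value (head π))))
        (ℕ.≤-trans (ℕ.m≤m+n (value (above π u d)) (weight π)) weight≤m)

    -- Values do not decrease towards the front, and a step from `ground` to value 0 has colour
    -- distance and excess 0, hence would be padding.
    admissible-positive : ∀ {π} → Admissible A π → π ≡ ground ∷ [] ⊎ 0 ℕ.< value (head π)
    admissible-positive single = inj₁ refl
    admissible-positive (step {π} u d Ad admissible ¬padding) with admissible-positive admissible
    ... | inj₂ 0<head = inj₂ (ℕ.≤-trans 0<head (ℕ.m≤m+n _ _))
    ... | inj₁ refl with ∣ toℕ u - toℕ i ∣ ℕ.+ d in eq
    ...   | suc _ = inj₂ (s≤s z≤n)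
    ...   | zero  = contradiction (cong (part 0) (toℕ-injective (ℕ.∣m-n∣≡0⇒m≡n (ℕ.m+n≡0⇒m≡0 _ eq))) , refl) ¬padding

    -- All parts but the last are at least 1. Thus only finitely many lengths occur for a given
    -- weight m, and m extensions reach them all.
    admissible-length : ∀ {π} → Admissible A π → List⁺.length π ℕ.≤ suc (weight π)
    admissible-length single = s≤s z≤n
    admissible-length (step {π} u d Ad admissible ¬padding) with admissible-positive (step {π = π} u d Ad admissible ¬padding)
    ... | inj₂ 0<head = s≤s (ℕ.≤-trans (admissible-length admissible) (ℕ.+-monoˡ-≤ (weight π) 0<head))

  -- Common treatment of both families: `G` is the gap condition, `P` the condition on the
  -- penultimate part, `A` the set of allowed excesses. Directly before `ground`, `P` amounts to
  -- being different from `ground`, that is, to the absence of padding.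
  module _ (G : Part → Part → Set) (P : Part → Set) (A : ℕ → Set)
    (gap      : ∀ {p r} → G p r → ∃[ d ] A d × value p ≡ value r ℕ.+ (colourDist p r ℕ.+ d))
    (fromGap  : ∀ p r d → A d → value p ≡ value r ℕ.+ (colourDist p r ℕ.+ d) → G p r)
    (≢ground  : ∀ {p} → P p → p ≢ ground)
    (≢ground⇒ : ∀ {p} → G p ground → p ≢ ground → P p)
    where

    Grounded : List⁺ Part → Set
    Grounded π = Linked G (toList π) × last π ≡ ground × Maybe.All P (penultimate π)

    admissible⇒grounded : ∀ {π} → Admissible A π → Grounded π
    admissible⇒grounded single = [-] , refl , nothing
    admissible⇒grounded (step {r ∷ []} u d Ad admissible ¬padding)
      with linked , refl , _ ← admissible⇒grounded admissible =
      G-step ∷ linked , refl , just (≢ground⇒ G-step λ p≡ → ¬padding (p≡ , refl))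
      where G-step = fromGap (above (r ∷ []) u d) r d Ad refl
    admissible⇒grounded (step {r ∷ s ∷ xs} u d Ad admissible ¬padding)
      with linked , last≡ , penult ← admissible⇒grounded admissible =
      fromGap p r d Ad refl ∷ linked
      , trans (last-∷⁺ p (r ∷ s ∷ xs)) last≡
      , subst (Maybe.All P) (sym (penultimate-∷⁺ p r s xs)) penult
      where p = above (r ∷ s ∷ xs) u d

    grounded⇒admissible : ∀ p xs → Grounded (p ∷ xs) → Admissible A (p ∷ xs)
    grounded⇒admissible p [] (_ , refl , _) = single
    grounded⇒admissible (part k u) (r ∷ xs) (Gpr ∷ linked , last≡ , penult) with gap Gpr
    ... | d , Ad , refl = step u d Ad (grounded⇒admissible r xs (linked , trans (sym (last-∷⁺ _ (r ∷ xs))) last≡ , penult′ xs penult))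
      (¬padding xs penult)
      where
      penult′ : ∀ xs → Maybe.All P (penultimate (part k u ∷ r ∷ xs)) → Maybe.All P (penultimate (r ∷ xs))
      penult′ []       _ = nothing
      penult′ (s ∷ xs) h = subst (Maybe.All P) (penultimate-∷⁺ _ r s xs) h
      ¬padding : ∀ xs → Maybe.All P (penultimate (part k u ∷ r ∷ xs)) → ¬ IsPadding (part k u) (r ∷ xs)
      ¬padding [] (just Pp) (p≡ , refl) = ≢ground Pp p≡

    grounded-count : ∀ m D N → m ℕ.≤ N → (∀ d → d ℕ.≤ D → A d) → (∀ d → A d → d ℕ.≤ m → d ℕ.≤ D) →
      HasCount (λ π → Linked G (toList π) × weight π ≡ m × last π ≡ ground × Maybe.All P (penultimate π))
               (length (filter (λ π → weight π ℕ.≟ m) (enumerate D N)))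
    grounded-count m D N m≤N ≤D⇒A A⇒≤D =
      filter hasWeight? (enumerate D N) , Unique.filter⁺ hasWeight? (enumerate-unique D N) , (λ π → mk⇔ (to π) (from π)) , refl
      where
      hasWeight? : ∀ π → Dec (weight π ≡ m)
      hasWeight? π = weight π ℕ.≟ m
      to : ∀ π → π ∈ filter hasWeight? (enumerate D N) → Linked G (toList π) × weight π ≡ m × last π ≡ ground × Maybe.All P (penultimate π)
      to π π∈ with π∈enumerate , weight≡m ← ∈-filter⁻ hasWeight? {xs = enumerate D N} π∈
        with linked , last≡ , penult ← admissible⇒grounded (enumerate-sound ≤D⇒A N π∈enumerate) =
        linked , weight≡m , last≡ , penult
      from : ∀ π → Linked G (toList π) × weight π ≡ m × last π ≡ ground × Maybe.All P (penultimate π) → π ∈ filter hasWeight? (enumerate D N)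
      from (p ∷ xs) (linked , weight≡m , last≡ , penult) = ∈-filter⁺ hasWeight?
        (enumerate-complete A⇒≤D N admissible (ℕ.≤-reflexive weight≡m)
          (ℕ.≤-trans (admissible-length admissible) (s≤s (ℕ.≤-trans (ℕ.≤-reflexive weight≡m) m≤N))))
        weight≡m
        where admissible = grounded⇒admissible p xs (linked , last≡ , penult)

  -- The generating function of the enumeration

  module Mass {c ℓ} (R : CommutativeRing c ℓ) (q : CommutativeRing.Carrier R) where
    open CommutativeRing R hiding (refl; sym; trans)
    open SemiringExp semiring
    open CommutativeRing R using () renaming (refl to ≈-refl; sym to ≈-sym; trans to ≈-trans)
    open SemiringSum semiring using (sum; sum-cong-≋)
    open SetoidReasoning setoid

    listSum : {X : Set} → (X → Carrier) → List X → Carrier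
    listSum φ []       = 0#
    listSum φ (x ∷ xs) = φ x + listSum φ xs

    listSum-cong : ∀ {X : Set} {φ ψ : X → Carrier} → (∀ x → φ x ≈ ψ x) → ∀ xs → listSum φ xs ≈ listSum ψ xs
    listSum-cong φ≈ψ []       = ≈-refl
    listSum-cong φ≈ψ (x ∷ xs) = +-cong (φ≈ψ x) (listSum-cong φ≈ψ xs)

    listSum-*ʳ : ∀ {X : Set} (φ : X → Carrier) a xs → listSum (λ x → φ x * a) xs ≈ listSum φ xs * a
    listSum-*ʳ φ a []       = ≈-sym (zeroˡ a)
    listSum-*ʳ φ a (x ∷ xs) = ≈-trans (+-congˡ (listSum-*ʳ φ a xs)) (≈-sym (distribʳ a _ _))

    listSum-cartesianProductWith : ∀ {X Y Z : Set} (φ : Z → Carrier) (h : X → Y → Z) xs ys →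
      listSum φ (cartesianProductWith h xs ys) ≈ listSum (λ x → listSum (λ y → φ (h x y)) ys) xs
    listSum-cartesianProductWith φ h []       ys = ≈-refl
    listSum-cartesianProductWith φ h (x ∷ xs) ys = go ys
      where
      go : ∀ zs → listSum φ (List.map (h x) zs ++ cartesianProductWith h xs ys)
                ≈ listSum (λ y → φ (h x y)) zs + listSum (λ x → listSum (λ y → φ (h x y)) ys) xs
      go []       = ≈-trans (listSum-cartesianProductWith φ h xs ys) (≈-sym (+-identityˡ _))
      go (z ∷ zs) = ≈-trans (+-congˡ (go zs)) (≈-sym (+-assoc _ _ _))

    listSum-tabulate : ∀ {X : Set} (φ : X → Carrier) {k} (h : Fin k → X) → listSum φ (tabulate h) ≈ sum (λ j → φ (h j))
    listSum-tabulate φ {zero}  h = ≈-refl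
    listSum-tabulate φ {suc k} h = +-congˡ (listSum-tabulate φ (λ j → h (suc j)))

    module _ (D : ℕ) where
      open GapIterates R q n D

      -- The state after summing over the k parts in front of `π`: each of them contains the value
      -- of the present head, whence k times that value in the exponent, and `f` collects their gaps
      -- as a function of the colour of the head.
      monomial : ℕ → (ℕ → Carrier) → List⁺ Part → Carrier
      monomial k f π = f (toℕ (colour (head π))) * q ^ (k ℕ.* value (head π) ℕ.+ weight π)

      monomial-extend : ∀ k f π u d → monomial k f (extend π (above π u d)) ≈
        f (toℕ u) * (q ^ suc k) ^ (∣ toℕ u - toℕ (colour (head π)) ∣ ℕ.+ d) * q ^ (suc k ℕ.* value (head π) ℕ.+ weight π)
      monomial-extend k f π u d = begin
        f (toℕ (colour (head (extend π p)))) * q ^ (k ℕ.* value (head (extend π p)) ℕ.+ weight (extend π p))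
          ≡⟨ cong₂ (λ r w → f (toℕ (colour r)) * q ^ (k ℕ.* value r ℕ.+ w)) (extend-head π p) (extend-weight π p) ⟩
        f (toℕ u) * q ^ (k ℕ.* (h ℕ.+ g) ℕ.+ ((h ℕ.+ g) ℕ.+ weight π))
          ≈⟨ *-congˡ (^-congʳ q (solve 4 (λ k h g w → k :* (h :+ g) :+ ((h :+ g) :+ w) := (con 1 :+ k) :* g :+ ((con 1 :+ k) :* h :+ w)) refl k h g (weight π))) ⟩
        f (toℕ u) * q ^ (suc k ℕ.* g ℕ.+ (suc k ℕ.* h ℕ.+ weight π))
          ≈⟨ *-congˡ (≈-trans (^-homo-* q (suc k ℕ.* g) _) (*-congʳ (≈-sym (^-assocʳ q (suc k) g)))) ⟩
        f (toℕ u) * ((q ^ suc k) ^ g * q ^ (suc k ℕ.* h ℕ.+ weight π))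
          ≈⟨ *-assoc _ _ _ ⟨
        f (toℕ u) * (q ^ suc k) ^ g * q ^ (suc k ℕ.* h ℕ.+ weight π) ∎
        where
        open +-*-Solver
        p = above π u d
        h = value (head π)
        g = ∣ toℕ u - toℕ (colour (head π)) ∣ ℕ.+ d

      -- A gap g below the foremost remaining part raises that part and the k parts already removed,
      -- which gives (q^(k+1))^g and so the transfer at x = q^(k+1).
      mass-step : ∀ k f N → listSum (monomial k f) (enumerate D (suc N)) ≈
                            listSum (monomial (suc k) (gapTransfer (q ^ suc k) f)) (enumerate D N)
      mass-step k f N = ≈-trans (listSum-cartesianProductWith (monomial k f) (extendBy D) (enumerate D N) (steps D))
        (listSum-cong inner (enumerate D N))
        where
        inner : ∀ π → listSum (λ s → monomial k f (extendBy D π s)) (steps D) ≈ monomial (suc k) (gapTransfer (q ^ suc k) f) π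
        inner π = begin
          listSum (λ s → monomial k f (extendBy D π s)) (steps D)
            ≈⟨ listSum-cong (λ (u , d) → monomial-extend k f π u (toℕ d)) (steps D) ⟩
          listSum (λ (u , d) → term u d * weightπ) (steps D)
            ≈⟨ listSum-*ʳ (λ (u , d) → term u d) weightπ (steps D) ⟩
          listSum (λ (u , d) → term u d) (steps D) * weightπ
            ≈⟨ *-congʳ (listSum-cartesianProductWith (λ (u , d) → term u d) _,_ (allFin (suc n)) (allFin (suc D))) ⟩
          listSum (λ u → listSum (λ d → term u d) (allFin (suc D))) (allFin (suc n)) * weightπ
            ≈⟨ *-congʳ (≈-trans (listSum-tabulate (λ u → listSum (λ d → term u d) (allFin (suc D))) {suc n} (λ u → u))
                 (sum-cong-≋ {suc n} (λ u → listSum-tabulate (λ d → term u d) {suc D} (λ d → d)))) ⟩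
          monomial (suc k) (gapTransfer (q ^ suc k) f) π ∎
          where
          weightπ = q ^ (suc k ℕ.* value (head π) ℕ.+ weight π)
          term : Fin (suc n) → Fin (suc D) → Carrier
          term u d = f (toℕ u) * (q ^ suc k) ^ (∣ toℕ u - toℕ (colour (head π)) ∣ ℕ.+ toℕ d)

      -- The matrix with x = q belongs to the gap nearest the front and is applied to 1 before all
      -- others; the process ends at the last part, whose colour is `i`.
      mass-gapIterate : ∀ k N → listSum (monomial k (gapIterate k)) (enumerate D N) ≈ gapIterate (k ℕ.+ N) (toℕ i)
      mass-gapIterate k zero = begin
        gapIterate k (toℕ i) * q ^ (k ℕ.* 0 ℕ.+ 0) + 0#   ≈⟨ +-identityʳ _ ⟩
        gapIterate k (toℕ i) * q ^ (k ℕ.* 0 ℕ.+ 0)        ≈⟨ *-congˡ (^-congʳ q (trans (ℕ.+-identityʳ _) (ℕ.*-zeroʳ k))) ⟩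
        gapIterate k (toℕ i) * 1#                         ≈⟨ *-identityʳ _ ⟩
        gapIterate k (toℕ i)                              ≡⟨ cong (λ K → gapIterate K (toℕ i)) (ℕ.+-identityʳ k) ⟨
        gapIterate (k ℕ.+ 0) (toℕ i)                      ∎
      mass-gapIterate k (suc N) = begin
        listSum (monomial k (gapIterate k)) (enumerate D (suc N))           ≈⟨ mass-step k (gapIterate k) N ⟩
        listSum (monomial (suc k) (gapIterate (suc k))) (enumerate D N)     ≈⟨ mass-gapIterate (suc k) N ⟩
        gapIterate (suc k ℕ.+ N) (toℕ i)                                    ≡⟨ cong (λ K → gapIterate K (toℕ i)) (ℕ.+-suc k N) ⟨
        gapIterate (k ℕ.+ suc N) (toℕ i)                                    ∎

-- The two counts and their series

open import Data.Nat using (_+_)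

q*-suc : ∀ f j → (q *ₛ f) (suc j) ≡ f j
q*-suc f j = trans (ℤ.+-identityˡ _) (trans (*ₛ-cong≤ {f = λ k → q (suc k)} {1ₛ} {f} {f} j (λ { zero _ → refl ; (suc _) _ → refl }) (λ _ _ → refl)) (*ₛ-identityˡ f j))

q^-coefficient : ∀ w → (q ^ₛ w) w ≡ 1ℤ
q^-coefficient zero    = refl
q^-coefficient (suc w) = trans (q*-suc (q ^ₛ w) w) (q^-coefficient w)

q^-coefficient-≢ : ∀ w j → w ≢ j → (q ^ₛ w) j ≡ 0ℤ
q^-coefficient-≢ zero    zero    w≢j = contradiction refl w≢j
q^-coefficient-≢ zero    (suc j) w≢j = refl
q^-coefficient-≢ (suc w) zero    w≢j = refl
q^-coefficient-≢ (suc w) (suc j) w≢j = trans (q*-suc (q ^ₛ w) j) (q^-coefficient-≢ w j (λ w≡j → w≢j (cong suc w≡j)))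

module _ {n : ℕ} {p r : ColouredPart n} where

  gap⇒difference : ∀ {d} → value p ≡ value r + (colourDist p r + d) → + value p ℤ.- + value r ≡ + (colourDist p r + d)
  gap⇒difference {d} eq = begin
    + value p ℤ.- + value r                                   ≡⟨ cong (λ k → + k ℤ.- + value r) eq ⟩
    + value r ℤ.+ + (colourDist p r + d) ℤ.- + value r        ≡⟨ cancel (+ value r) (+ (colourDist p r + d)) ⟩
    + (colourDist p r + d)                                    ∎
    where
    open ≡.≡-Reasoning
    cancel : ∀ a b → a ℤ.+ b ℤ.- a ≡ b
    cancel = solveℤ-∀

  difference⇒gap : ∀ {k} → + value p ℤ.- + value r ≡ + k → value p ≡ value r + k
  difference⇒gap {k} eq = ℤ.+-injective (begin
    + value p                                      ≡⟨ regroup (+ value p) (+ value r) ⟩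
    + value r ℤ.+ (+ value p ℤ.- + value r)        ≡⟨ cong (ℤ._+_ (+ value r)) eq ⟩
    + value r ℤ.+ + k                              ∎)
    where
    open ≡.≡-Reasoning
    regroup : ∀ a b → a ≡ b ℤ.+ (a ℤ.- b)
    regroup = solveℤ-∀

module _ {c ℓ} (R : CommutativeRing c ℓ) where
  open CommutativeRing R hiding (refl; sym; trans)
  open CommutativeRing R using () renaming (refl to ≈-refl)
  open IntegerCoefficients R using (solve; _:=_; _:*_; con)
  open SetoidReasoning setoid

  -- `H` cancels the gap product `G`, leaving the product formula for the iterate `I`; the final
  -- `1#` is the end of the fold in `pochs∞`.
  clear-gaps : ∀ {F G H I O D Y z w E} → F ≈ G * I → G * H ≈ 1# → Y ≈ O * D * H → I * (O * D) ≈ z * w * E →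
               F * Y ≈ z * (w * (E * 1#))
  clear-gaps {F} {G} {H} {I} {O} {D} {Y} {z} {w} {E} F≈GI GH≈1 Y≈ODH product = begin
    F * Y                     ≈⟨ *-cong F≈GI Y≈ODH ⟩
    G * I * (O * D * H)       ≈⟨ solve 5 (λ g i o d h → g :* i :* (o :* d :* h) := g :* h :* (i :* (o :* d))) ≈-refl G I O D H ⟩
    G * H * (I * (O * D))     ≈⟨ *-cong GH≈1 product ⟩
    1# * (z * w * E)          ≈⟨ solve 3 (λ z w e → con 1ℤ :* (z :* w :* e) := z :* (w :* (e :* con 1ℤ))) ≈-refl z w E ⟩
    z * (w * (E * 1#))        ∎

module Counts (n : ℕ) (i : Fin (suc n)) where
  open Enumeration n i

  count : ℕ → ℕ → ℕ → ℕ
  count D N m = length (filter (λ π → weight π ℕ.≟ m) (enumerate D N))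

  count-𝒞 : ∀ m N → m ℕ.≤ N → HasCount (CountedByC n i m) (count 0 N m)
  count-𝒞 m N m≤N = grounded-count
    (λ p r → + value p ℤ.- + value r ≡ + colourDist p r) (λ p → colour p ≢ i) (_≡ 0)
    (λ {p} {r} G → 0 , refl , trans (difference⇒gap {p = p} {r} G) (cong (ℕ._+_ (value r)) (sym (ℕ.+-identityʳ _))))
    (λ { p r .0 refl eq → trans (gap⇒difference {p = p} {r} eq) (cong +_ (ℕ.+-identityʳ _)) })
    (λ { colour≢ refl → colour≢ refl })
    -- Next to `ground` the value equals the colour distance, so colour `i` would force the value 0.
    (λ { {p} G p≢ground refl → p≢ground (cong (λ k → part k i) (trans (difference⇒gap {p = p} {ground} G) (ℕ.∣n-n∣≡0 (toℕ i)))) })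
    m 0 N m≤N (λ _ → ℕ.n≤0⇒n≡0) (λ { _ refl _ → z≤n })

  count-𝒞≥ : ∀ m N → m ℕ.≤ N → HasCount (CountedByC≥ n i m) (count m N m)
  count-𝒞≥ m N m≤N = grounded-count
    (λ p r → + colourDist p r ℤ.≤ + value p ℤ.- + value r) (λ p → p ≢ ground) (λ _ → ⊤)
    (λ {p} {r} G → gap {p} {r} G)
    (λ p r d _ eq → subst (+ colourDist p r ℤ.≤_) (sym (gap⇒difference {p = p} {r} eq)) (ℤ.+≤+ (ℕ.m≤m+n _ d)))
    (λ p≢ground → p≢ground)
    (λ _ p≢ground → p≢ground)
    m m N m≤N (λ _ _ → tt) (λ _ _ d≤m → d≤m)
    where
    gap : ∀ {p r} → + colourDist p r ℤ.≤ + value p ℤ.- + value r → ∃[ d ] ⊤ × value p ≡ value r + (colourDist p r + d)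
    gap {p} {r} G with + value p ℤ.- + value r in eq | G
    ... | + k | ℤ.+≤+ dist≤k = k ∸ colourDist p r , tt ,
      trans (difference⇒gap {p = p} {r} eq) (cong (ℕ._+_ (value r)) (sym (ℕ.m+[n∸m]≡n dist≤k)))

  module GeneratingFunction (m : ℕ) where
    open Truncated m using (^≡^ₛ)
    private
      module T = Truncated m
      R = truncatedRing m

    open Mass R q

    coefficient-count : ∀ D xs → listSum (monomial D 0 (λ _ → 1ₛ)) xs m ≡ + length (filter (λ π → weight π ℕ.≟ m) xs)
    coefficient-count D []       = refl
    coefficient-count D (π ∷ xs) = cons (weight π ℕ.≟ m)
      where
      power : ∀ {c} → (q ^ₛ weight π) m ≡ c → (1ₛ *ₛ q T.^ weight π) m ≡ c
      power eq = trans (*ₛ-identityˡ (q T.^ weight π) m) (trans (cong (λ f → f m) (^≡^ₛ q (weight π))) eq)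
      cons : Dec (weight π ≡ m) → listSum (monomial D 0 (λ _ → 1ₛ)) (π ∷ xs) m ≡ + length (filter (λ π → weight π ℕ.≟ m) (π ∷ xs))
      cons (yes w≡m) = trans
        (cong₂ ℤ._+_ (power (trans (cong (q ^ₛ weight π) (sym w≡m)) (q^-coefficient (weight π)))) (coefficient-count D xs))
        (cong (λ πs → + length πs) (sym (filter-accept (λ π → weight π ℕ.≟ m) {x = π} {xs = xs} w≡m)))
      cons (no  w≢m) = trans
        (cong₂ ℤ._+_ (power (q^-coefficient-≢ (weight π) m w≢m)) (coefficient-count D xs))
        (trans (ℤ.+-identityˡ _) (cong (λ πs → + length πs) (sym (filter-reject (λ π → weight π ℕ.≟ m) {x = π} {xs = xs} w≢m))))

    count-gapIterate : ∀ D N → + count D N m ≡ GapIterates.gapIterate R q n D N (toℕ i) m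
    count-gapIterate D N = trans (sym (coefficient-count D (enumerate D N)))
      (_≈[_]_.coefficient (mass-gapIterate D 0 N) m ℕ.≤-refl)

    -- m extensions would exhaust the sequences of weight m; 2m + 1 is the value at which `J-stable`
    -- applies.
    N : ℕ
    N = suc (m + m)

    v : ℕ
    v = toℕ i

    v≤n : v ℕ.≤ n
    v≤n = toℕ≤pred[n] i

    m<N : m ℕ.< N
    m<N = s≤s (ℕ.m≤m+n m m)

    Q z w : Series
    Q = q T.^ suc (suc n)
    z = q T.^ suc v
    w = q T.^ (suc n ∸ v)

    w₀≡0 : w 0 ≡ 0ℤ
    w₀≡0 rewrite ℕ.+-∸-assoc 1 v≤n = refl

    numerator : Series → Series → Series → Series
    numerator z w Q = pochs∞ (z ∷ w ∷ Q ∷ []) Q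

    numerator-cong : ∀ {z z′ w w′ Q Q′} → z ≡ z′ → w ≡ w′ → Q ≡ Q′ → numerator z w Q ≡ numerator z′ w′ Q′
    numerator-cong refl refl refl = refl

    numerator-≡ : numerator (q ^ₛ (v + 1)) (q ^ₛ (n ∸ v + 1)) (q ^ₛ (n + 2)) ≡ numerator z w Q
    numerator-≡ = numerator-cong (power-≡ (ℕ.+-comm v 1))
      (power-≡ (trans (ℕ.+-comm (n ∸ v) 1) (sym (ℕ.+-∸-assoc 1 v≤n)))) (power-≡ (ℕ.+-comm n 2))
      where
      power-≡ : ∀ {k l} → k ≡ l → q ^ₛ k ≡ q T.^ l
      power-≡ {k} refl = sym (^≡^ₛ q k)

    torsion-free = truncated-torsion-free m
    inv = T.powerInverse q
    inv-inverse = T.powerInverse-inverse q refl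

    open TransferIterates R torsion-free q inv inv-inverse n using (iterate)

    product : iterate N v *ₛ (poch∞ q (q ^ₛ 2) *ₛ poch∞ q q) T.≈ poch∞ z Q *ₛ poch∞ w Q *ₛ poch∞ Q Q
    product = T.trans
      (T.*-congˡ {x = iterate N v} (T.*-congʳ {x = poch∞ q q} (T.sym (T.trans
        (T.pochhammer≈poch∞ q (q T.^ 2) refl N m<N) (T.reflexive (cong (poch∞ q) (^≡^ₛ q 2)))))))
      (T.trans
        (IterateProduct.iterate-product R torsion-free q inv inv-inverse n
          (T.powerInverse Q) (T.powerInverse-inverse Q refl) m v v≤n (poch∞ q q) (poch∞ Q Q)
          (T.pochhammer≈poch∞ q q refl) (T.pochhammer≈poch∞ Q Q refl)
          (λ k m<k → Order≥⇒≈0 m<k (T.θ-order Q z refl k)) (λ k m<k → Order≥⇒≈0 m<k (T.θ-order Q w w₀≡0 k)))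
        (T.*-congʳ {x = poch∞ Q Q} (T.*-cong (T.pochhammer≈poch∞ z Q refl N m<N) (T.pochhammer≈poch∞ w Q refl N m<N))))

    -- `H` is the inverse of the gap product: 1 for `D = 0` and (q;q)_∞ for `D = m`, the latter
    -- being the additional factor in the second denominator.
    series : ∀ D H Y → Y 0 ≡ 1ℤ → GapIterates.gapProduct R q n D N *ₛ H T.≈ 1ₛ →
             Y T.≈ poch∞ q (q ^ₛ 2) *ₛ poch∞ q q *ₛ H →
             + count D N m ≡ (numerator (q ^ₛ (v + 1)) (q ^ₛ (n ∸ v + 1)) (q ^ₛ (n + 2)) /ₛ Y) m
    series D H Y Y₀≡1 GH≈1 Y≈ = trans (count-gapIterate D N) (trans
      (_≈[_]_.coefficient (T.*-/ₛ {gapIterate N v} {Y} {numerator z w Q} Y₀≡1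
        (clear-gaps R {gapIterate N v} {gapProduct N} {H} {iterate N v} {poch∞ q (q ^ₛ 2)} {poch∞ q q} {Y} {poch∞ z Q} {poch∞ w Q} {poch∞ Q Q}
          (gapIterate-factor torsion-free inv inv-inverse N v) GH≈1 Y≈ product)) m ℕ.≤-refl)
      (cong (λ f → (f /ₛ Y) m) (sym numerator-≡)))
      where open GapIterates R q n D

    odd₀≡1 : poch∞ q (q ^ₛ 2) 0 ≡ 1ℤ
    odd₀≡1 = poch∞-constant q (q ^ₛ 2) refl

    all₀≡1 : poch∞ q q 0 ≡ 1ℤ
    all₀≡1 = poch∞-constant q q refl

    series-𝒞 : + count 0 N m ≡ (numerator (q ^ₛ (v + 1)) (q ^ₛ (n ∸ v + 1)) (q ^ₛ (n + 2)) /ₛ (poch∞ q (q ^ₛ 2) *ₛ poch∞ q q)) m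
    series-𝒞 = series 0 1ₛ (poch∞ q (q ^ₛ 2) *ₛ poch∞ q q)
      (*ₛ-constant-1 (poch∞ q (q ^ₛ 2)) (poch∞ q q) odd₀≡1 all₀≡1)
      (T.trans (T.*-identityʳ (GapIterates.gapProduct R q n 0 N)) (SingleGap.gapProduct-zero R q n N))
      (T.sym (T.*-identityʳ (poch∞ q (q ^ₛ 2) *ₛ poch∞ q q)))

    series-𝒞≥ : + count m N m ≡ (numerator (q ^ₛ (v + 1)) (q ^ₛ (n ∸ v + 1)) (q ^ₛ (n + 2)) /ₛ (poch∞ q (q ^ₛ 2) *ₛ poch∞ q q ^ₛ 2)) m
    series-𝒞≥ = series m (poch∞ q q) (poch∞ q (q ^ₛ 2) *ₛ poch∞ q q ^ₛ 2)
      (*ₛ-constant-1 (poch∞ q (q ^ₛ 2)) (poch∞ q q ^ₛ 2) odd₀≡1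
        (*ₛ-constant-1 (poch∞ q q) (poch∞ q q *ₛ 1ₛ) all₀≡1 (*ₛ-constant-1 (poch∞ q q) 1ₛ all₀≡1 refl)))
      (T.trans (T.*-congˡ {x = gapProduct N} (T.sym (T.pochhammer≈poch∞ q q refl N m<N)))
        (gapProduct-pochhammer nilpotent N))
      (T.trans (T.*-congˡ {x = poch∞ q (q ^ₛ 2)} (T.*-congˡ {x = poch∞ q q} (T.*-identityʳ (poch∞ q q))))
        (T.sym (T.*-assoc (poch∞ q (q ^ₛ 2)) (poch∞ q q) (poch∞ q q))))
      where
      open GapIterates R q n m
      -- Without a constant term, q^(k+1) has a vanishing (m+1)-st power modulo q^(m+1); the choice
      -- `D = m` matches this exponent.
      nilpotent : ∀ k → (q T.^ suc k) T.^ suc m T.≈ T.0#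
      nilpotent k = T.trans (T.reflexive (^≡^ₛ (q T.^ suc k) (suc m)))
        (Order≥⇒≈0 ℕ.≤-refl (^ₛ-order (q T.^ suc k) refl (suc m)))

theorem1p6 : (n : ℕ) (i : Fin (suc n)) →
    ∃[ C ] ∃[ C≥ ]
    (∀ m → HasCount (CountedByC n i m) (C m))
    × (∀ m → HasCount (CountedByC≥ n i m) (C≥ m))
    × genFun C ≗
    pochs∞ (q ^ₛ (toℕ i + 1) ∷ q ^ₛ (n ∸ toℕ i + 1) ∷ q ^ₛ (n + 2) ∷ []) (q ^ₛ (n + 2))
    /ₛ (poch∞ q (q ^ₛ 2) *ₛ poch∞ q q)
    × genFun C≥ ≗
    pochs∞ (q ^ₛ (toℕ i + 1) ∷ q ^ₛ (n ∸ toℕ i + 1) ∷ q ^ₛ (n + 2) ∷ []) (q ^ₛ (n + 2))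
    /ₛ (poch∞ q (q ^ₛ 2) *ₛ poch∞ q q ^ₛ 2)
theorem1p6 n i =
    (λ m → count 0 (suc (m + m)) m)
  , (λ m → count m (suc (m + m)) m)
  , (λ m → count-𝒞 m (suc (m + m)) (m≤ m))
  , (λ m → count-𝒞≥ m (suc (m + m)) (m≤ m))
  , (λ m → GeneratingFunction.series-𝒞 m)
  , (λ m → GeneratingFunction.series-𝒞≥ m)
  where
  open Counts n i
  m≤ : ∀ m → m ℕ.≤ suc (m + m)
  m≤ m = ℕ.≤-trans (ℕ.m≤m+n m m) (ℕ.n≤1+n _)
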